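{- Let $\vec G=(V,\vec E)$ be a finite directed graph, let $d\in\mathbb{Z}^V\setminus\{0\}$ and let $u,l\in\mathbb{Z}^{\vec E}$. Let $F=F_{\vec G,d,u,l}$ be the associated flow polytope. Then the toric ideal $I_F$ is generated in degree three, i.e. $I_F$ has a generating set consisting of polynomials of degree at most $3$.
   Context: Flow polytope: for a finite directed graph $\vec G=(V,\vec E)$, $\vec E\subseteq V\times V$, a demand vector $d\in\mathbb{Z}^V\setminus\{0\}$, and upper and lower bounds $u,l\in\mathbb{Z}^{\vec E}$, $$F_{\vec G,d,u,l}=\Big\{f:\vec E\to\mathbb{R}_{\ge 0}\ \Big|\ \sum_{e \text{ entering } v}f(e)-\sum_{e\text{ leaving }v}f(e)=d_v\ \ \forall v\in V,\ \ l_e\le f(e)\le u_e\ \ \forall e\in\vec E\Big\}\subseteq\mathbb{R}^{\vec E}.$$ It is a lattice polytope. Toric ideal: let $k$ be a field. For a lattice polytope $P\subseteq\mathbb{R}^N$ put $\mathcal{A}=P\cap\mathbb{Z}^N$. The toric ideal $I_P=I_{\mathcal A}$ is the kernel of the $k$-algebra homomorphism $k[x_a : a\in\mathcal{A}]\to k[t_1^{\pm1},\dots,t_N^{\pm1}]$, $x_a\mapsto t^a$. An ideal is "generated in degree $q$" if it has a generating set all of whose elements have degree at most $q$ (all variables have degree $1$). -}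

module Defs where

open import Level using (Level; _⊔_) renaming (suc to lsuc)
open import Algebra.Bundles using (CommutativeMonoid; CommutativeRing)
open import Algebra.Bundles.Raw using (RawRing)
open import Algebra.Apartness.Bundles using (HeytingField; HeytingCommutativeRing)
open import Data.Bool.Base using (if_then_else_)
open import Data.Fin.Base using (Fin)
import Data.Fin.Properties as Fin
open import Data.Integer.Base as ℤ using (ℤ; 0ℤ)
import Data.Integer.Properties as ℤ
open import Data.List.Base as List using (List; []; _∷_; _++_)
open import Data.List.Membership.Propositional.Properties using (∈-∃++)
open import Data.List.Relation.Binary.Permutation.Propositional
  using (_↭_; ↭-refl; ↭-sym; ↭-trans; prep)
open import Data.List.Relation.Binary.Permutation.Propositional.Properties
  using (++-commutativeMonoid; ∈-resp-↭; ¬x∷xs↭[]; drop-∷; shift)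
open import Data.List.Relation.Unary.Any using (here)
open import Data.Nat.Base as ℕ using (ℕ)
open import Data.Product.Base using (_×_; _,_; proj₁; proj₂; Σ-syntax)
open import Data.Refinement as Refinement using (Refinement; value)
open import Data.Vec.Base as Vec using (Vec; lookup; zipWith; replicate)
import Data.Vec.Properties as Vec
open import Data.Vec.Relation.Unary.Unique.Propositional using (Unique)
open import Relation.Binary.Definitions using (Decidable; DecidableEquality)
open import Relation.Binary.PropositionalEquality
  using (_≡_; refl; cong₂; isEquivalence)
open import Relation.Nullary.Decidable using (yes; no; does; map′)
open import Relation.Unary using (Pred; _∈_; _⊆_; _≐_)

open import Algebra.Properties.CommutativeMonoid.Sum ℤ.+-0-commutativeMonoid
  using (sum-syntax)

private
  variable
    a c ℓ m r s : Level

module Ideal (R : RawRing c ℓ) where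

  open RawRing R

  -- The smallest subset containing S that respects _≈_ and is closed under
  -- addition and under multiplication by arbitrary ring elements.
  data ⟨_⟩ (S : Pred Carrier s) : Pred Carrier (c ⊔ ℓ ⊔ s) where
    generator : ∀ {p} → p ∈ S → p ∈ ⟨ S ⟩
    zero      : 0# ∈ ⟨ S ⟩
    add       : ∀ {p q} → p ∈ ⟨ S ⟩ → q ∈ ⟨ S ⟩ → (p + q) ∈ ⟨ S ⟩
    multiply  : ∀ p {q} → q ∈ ⟨ S ⟩ → (p * q) ∈ ⟨ S ⟩
    respects  : ∀ {p q} → p ≈ q → p ∈ ⟨ S ⟩ → q ∈ ⟨ S ⟩

-- The monoid algebra K[M]: an element is a formal finite sum of terms (c , m),
-- standing for c·m; the same m may occur repeatedly and coefficients may
-- vanish.  Two formal sums are equal when every m has the same total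
-- coefficient.
module MonoidAlgebra
  (K : CommutativeRing c ℓ) (M : CommutativeMonoid a m)
  (_≟_ : Decidable (CommutativeMonoid._≈_ M))
  where

  private
    module K = CommutativeRing K
    module M = CommutativeMonoid M

  Element : Set (c ⊔ a)
  Element = List (K.Carrier × M.Carrier)

  coefficient : M.Carrier → Element → K.Carrier
  coefficient m []            = K.0#
  coefficient m ((c , n) ∷ p) =
    if does (m ≟ n) then c K.+ coefficient m p else coefficient m p

  rawRing : RawRing (c ⊔ a) (a ⊔ ℓ)
  rawRing = record
    { Carrier = Element
    ; _≈_     = λ p q → ∀ m → coefficient m p K.≈ coefficient m q
    ; _+_     = _++_
    ; _*_     = List.cartesianProductWith
                  (λ (c , m) (d , n) → (c K.* d , m M.∙ n))
    ; -_      = List.map (λ (c , m) → (K.- c , m))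
    ; 0#      = []
    ; 1#      = (K.1# , M.ε) ∷ []
    }

-- Monomials in variables x_a (a : A) are finite multisets over A: lists up
-- to permutation, multiplied by concatenation.  The total degree is the
-- length.
module _ {A : Set a} (_≟_ : DecidableEquality A) where

  open import Data.List.Membership.DecPropositional _≟_ using (_∈?_)

  ↭-decidable : Decidable (_↭_ {A = A})
  ↭-decidable []       []       = yes ↭-refl
  ↭-decidable []       (y ∷ ys) = no λ p → ¬x∷xs↭[] (↭-sym p)
  ↭-decidable (x ∷ xs) ys with x ∈? ys
  ... | no x∉ys = no λ p → x∉ys (∈-resp-↭ p (here refl))
  ... | yes x∈ys with ∈-∃++ x∈ys
  ...   | as , bs , refl = map′
            (λ p → ↭-trans (prep x p) (↭-sym (shift x as bs)))
            (λ p → drop-∷ (↭-trans p (shift x as bs)))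
            (↭-decidable xs (as ++ bs))

  module Polynomial (K : CommutativeRing c ℓ) where

    open MonoidAlgebra K (++-commutativeMonoid {A = A}) ↭-decidable public
      renaming (Element to Poly; rawRing to polynomialRing)

    open Ideal polynomialRing public

    -- Every monomial of degree exceeding q has coefficient zero.  Stated
    -- this way because a formal sum may contain cancelling terms.
    DegreeAtMost : ℕ → Pred Poly (a ⊔ ℓ)
    DegreeAtMost q p = ∀ m → q ℕ.< List.length m → coefficient m p K.≈ K.0#
      where module K = CommutativeRing K

    GeneratedInDegree : ∀ {i} → ℕ → Pred Poly i → Set (lsuc (c ⊔ ℓ) ⊔ a ⊔ i)
    GeneratedInDegree q I =
      Σ[ S ∈ Pred Poly (c ⊔ ℓ) ]
        S ⊆ DegreeAtMost q ×
        ⟨ S ⟩ ≐ I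

-- ℤᴺ written additively; its monoid algebra is the ring of Laurent
-- polynomials k[t₁^±1 , … , t_N^±1].
ℤ^ : ℕ → CommutativeMonoid _ _
ℤ^ N = record
  { Carrier = Vec ℤ N
  ; _≈_     = _≡_
  ; _∙_     = zipWith ℤ._+_
  ; ε       = replicate N 0ℤ
  ; isCommutativeMonoid = record
    { isMonoid = record
      { isSemigroup = record
        { isMagma = record
          { isEquivalence = isEquivalence
          ; ∙-cong        = cong₂ (zipWith ℤ._+_)
          }
        ; assoc = Vec.zipWith-assoc ℤ.+-assoc
        }
      ; identity = Vec.zipWith-identityˡ ℤ.+-identityˡ
                 , Vec.zipWith-identityʳ ℤ.+-identityʳ
      }
    ; comm = Vec.zipWith-comm ℤ.+-comm
    }
  }

_≟ᵛ_ : ∀ {N} → DecidableEquality (Vec ℤ N)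
_≟ᵛ_ = Vec.≡-dec ℤ._≟_

module Toric {N : ℕ} (K : CommutativeRing c ℓ) (𝒜 : Pred (Vec ℤ N) r) where

  -- Refinement makes the membership proof irrelevant, so that there is
  -- exactly one variable for each lattice point.
  Point : Set r
  Point = Refinement (Vec ℤ N) 𝒜

  open Polynomial {A = Point} (Refinement._≟_ _≟ᵛ_) K public
  module Laurent = MonoidAlgebra K (ℤ^ N) _≟ᵛ_

  -- x_{a₁}⋯x_{aᵣ} ↦ t^{a₁ + ⋯ + aᵣ}
  exponent : List Point → Vec ℤ N
  exponent = List.foldr (λ a v → zipWith ℤ._+_ (value a) v) (replicate N 0ℤ)

  -- The K-algebra homomorphism determined by x_a ↦ t^a.
  φ : Poly → Laurent.Element
  φ = List.map (λ (c , m) → (c , exponent m))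

  toricIdeal : Pred Poly ℓ
  toricIdeal p = RawRing._≈_ Laurent.rawRing (φ p) (RawRing.0# Laurent.rawRing)

-- An edge (v , w) leaves v and enters w.  Uniqueness makes the edges a
-- subset of V × V; loops and antiparallel pairs are allowed.
record Digraph : Set where
  field
    #V     : ℕ
    #E     : ℕ
    edge   : Vec (Fin #V × Fin #V) #E
    unique : Unique edge

  source target : Fin #E → Fin #V
  source e = proj₁ (lookup edge e)
  target e = proj₂ (lookup edge e)

module _ (G : Digraph) where
  open Digraph G

  inflow outflow : Vec ℤ #E → Fin #V → ℤ
  inflow  f v = ∑[ e < #E ] (if does (target e Fin.≟ v) then lookup f e else 0ℤ)
  outflow f v = ∑[ e < #E ] (if does (source e Fin.≟ v) then lookup f e else 0ℤ)

  -- Membership of an integer vector in the flow polytope: these are the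
  -- lattice points F ∩ ℤᴱ, and the real points of F are never needed.
  record FlowPolytopePoint (d : Vec ℤ #V) (u l : Vec ℤ #E) (f : Vec ℤ #E) : Set where
    field
      nonNegative  : ∀ e → 0ℤ ℤ.≤ lookup f e
      conservation : ∀ v → inflow f v ℤ.- outflow f v ≡ lookup d v
      lower        : ∀ e → lookup l e ℤ.≤ lookup f e
      upper        : ∀ e → lookup f e ℤ.≤ lookup u e

-- In a Heyting field an element apart from 0 is invertible, and apartness is
-- tight; every field with decidable equality is one (and, classically, every
-- field is), taking x # y to be ¬ x ≈ y.  0 ≉ 1 follows from irreflexivity.
fieldRing : ∀ {c ℓ₁ ℓ₂} → HeytingField c ℓ₁ ℓ₂ → CommutativeRing c ℓ₁
fieldRing k = HeytingCommutativeRing.commutativeRing (HeytingField.heytingCommutativeRing k)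

{-# OPTIONS --safe #-}
module Submission where

open import Defs
open import Algebra.Apartness.Bundles using (HeytingField)
open import Algebra.Bundles using (CommutativeRing)
open import Algebra.Bundles.Raw using (RawRing)
open import Data.Bool.Base using (if_then_else_; true; false)
open import Data.Fin.Base using (Fin; zero; suc)
import Data.Fin.Properties as Fin
open import Data.Integer.Base as ℤ using (ℤ; 0ℤ; 1ℤ; +_; -[1+_]; _+_; _*_; -_; _-_; ∣_∣)
import Data.Integer.Properties as ℤ
import Data.Integer.DivMod as ℤ
open import Data.Integer.Divisibility.Signed as ℤ using (_∣_; _∣?_; divides)
open import Data.Integer.Tactic.RingSolver using (solve-∀)
open import Data.List.Base as List using (List; []; _∷_; _++_; length)
open import Data.List.Relation.Binary.Permutation.Propositional
  using (_↭_; ↭-refl; ↭-sym; ↭-trans; ↭-isEquivalence; prep; swap)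
open import Data.List.Relation.Binary.Permutation.Propositional.Properties
  using (shift; ↭-length; ++-comm)
open import Data.List.Membership.Propositional using (find)
open import Data.List.Membership.Propositional.Properties using (∈-∃++)
open import Data.List.Relation.Unary.Any using (Any; here; there; any?)
open import Data.Nat.Base as ℕ using (ℕ; z≤n; s≤s)
open import Data.Nat.Induction using (Acc; acc; <-wellFounded)
import Data.Nat.Divisibility as ℕ using (∣1⇒≡1)
import Data.Nat.Properties as ℕ
open import Data.Product.Base using (∃; ∃₂; _×_; _,_; proj₁; proj₂)
open import Data.Refinement as Refinement using (Refinement; value; _,_)
open import Data.Irrelevant using ([_])
open import Data.Sign.Base as Sign using (Sign)
open import Data.Vec.Base using (Vec; lookup; replicate; tabulate; zipWith)
open import Data.Vec.Properties using (lookup∘tabulate; tabulate∘lookup; tabulate-cong; lookup-replicate; lookup-zipWith)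
open import Function.Base using (_∘_)
open import Function.Bundles using (_⇔_; mk⇔; Equivalence)
open import Function.Properties.Equivalence using () renaming (refl to ⇔-refl)
open import Level using (_⊔_)
import Relation.Binary as Binary
open import Relation.Binary using (Rel; IsEquivalence)
import Relation.Binary.Construct.On as On
open import Relation.Binary.PropositionalEquality
open import Relation.Nullary using (¬_; Dec; yes; no; does; contradiction; ¬?)
open import Relation.Nullary.Decidable using (recompute; decidable-stable; dec-true; dec-false)
open import Relation.Unary using (Pred; Decidable)

open import Algebra.Properties.AbelianGroup ℤ.+-0-abelianGroup using () renaming (∙-cancelˡ to +-cancelˡ)
open import Algebra.Properties.Semiring.Sum ℤ.+-*-semiring
  using (sum; ∑-distrib-+; sum-cong-≗; sum-replicate-zero)
import Algebra.Properties.CommutativeMonoid.Sum ℕ.+-0-commutativeMonoid as ℕΣ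

-- Binomials generate a toric ideal, so it is enough to connect two lists ps, qs of
-- integer flows with equal sum by exchanges of at most three flows; their lengths
-- agree because d ≠ 0.  Turn some flow f of ps into a given flow g of qs one unit
-- at a time: at a vertex where f has an excess, moving the unit along some edge
-- brings f closer to g, and since the sums agree another row can pay for it.
-- The rows are then feasible flows except for f and a row h with the opposite
-- defect, and this state is represented by any two feasible flows with the sum
-- f + h.  They exist because halving an integral flow can be rounded, edge by edge,
-- to an integral flow.  One unit later only three of the representing rows differ.

-- Finite sums and halving of inequalities.

-- If all terms lay in `P`, closure under addition would put the sum there. The two uses take `P` to
-- be evenness and being at most 0.
∃-summand : ∀ {p} {P : Pred ℤ p} → Decidable P → P 0ℤ → (∀ {i j} → P i → P j → P (i + j)) →
            ∀ {n} (t : Fin n → ℤ) → ¬ P (sum t) → ∃ λ i → ¬ P (t i)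
∃-summand P? P0 P+ {ℕ.zero}  t ¬P = contradiction P0 ¬P
∃-summand P? P0 P+ {ℕ.suc n} t ¬P with P? (t zero)
... | no ¬Pt₀ = zero , ¬Pt₀
... | yes Pt₀ with i , ¬Pt ← ∃-summand P? P0 P+ (t ∘ suc) (¬P ∘ P+ Pt₀) = suc i , ¬Pt

sum-mono-≤ : ∀ {n} {s t : Fin n → ℕ} → (∀ i → s i ℕ.≤ t i) → ℕΣ.sum s ℕ.≤ ℕΣ.sum t
sum-mono-≤ {ℕ.zero}  s≤t = z≤n
sum-mono-≤ {ℕ.suc n} s≤t = ℕ.+-mono-≤ (s≤t zero) (sum-mono-≤ (s≤t ∘ suc))

sum-mono-< : ∀ {n} {s t : Fin n → ℕ} → (∀ i → s i ℕ.≤ t i) →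
             ∀ j → s j ℕ.< t j → ℕΣ.sum s ℕ.< ℕΣ.sum t
sum-mono-< s≤t zero    s<t = ℕ.+-mono-<-≤ s<t (sum-mono-≤ (s≤t ∘ suc))
sum-mono-< s≤t (suc j) s<t = ℕ.+-mono-≤-< (s≤t zero) (sum-mono-< (s≤t ∘ suc) j s<t)

sum-neg : ∀ {n} (s : Fin n → ℤ) → sum (λ i → - s i) ≡ - sum s
sum-neg {ℕ.zero}  s = refl
sum-neg {ℕ.suc n} s = trans (cong (λ i → - s zero + i) (sum-neg (s ∘ suc))) (sym (ℤ.neg-distrib-+ (s zero) _))

-- An error of one does not matter between doubles: `j < i` would give `j + j + 2 ≤ i + i`. Bounds
-- therefore survive the rounding of halves.
halve-≤ : ∀ {i j} → i + i ℤ.≤ j + j + 1ℤ → i ℤ.≤ j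
halve-≤ {i} {j} le with i ℤ.≤? j
... | yes i≤j = i≤j
... | no  i≰j = contradiction
  (ℤ.suc[i]≤j⇒i<j (ℤ.≤-trans (ℤ.≤-reflexive (lemma j)) (ℤ.≤-trans (ℤ.+-mono-≤ j<i j<i) le)))
  (ℤ.<-irrefl refl)
  where
  j<i : ℤ.suc j ℤ.≤ i
  j<i = ℤ.i<j⇒suc[i]≤j (ℤ.≰⇒> i≰j)

  lemma : ∀ j → 1ℤ + (j + j + 1ℤ) ≡ (1ℤ + j) + (1ℤ + j)
  lemma = solve-∀

-- Parity.

Even : ℤ → Set
Even i = + 2 ∣ i

opaque
  even? : Decidable Even
  even? i = + 2 ∣? i

odd⇒even+1 : ∀ {i} → ¬ Even i → Even (i + 1ℤ)
odd⇒even+1 {i} odd with i ℤ.%ℕ 2 in r | ℤ.a≡a%ℕn+[a/ℕn]*n i 2 | ℤ.n%ℕd<d i 2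
... | 0 | eq | _ = contradiction (divides (i ℤ./ℕ 2) (trans eq (ℤ.+-identityˡ _))) odd
... | 1 | eq | _ = divides (1ℤ + i ℤ./ℕ 2) (trans (cong (_+ 1ℤ) eq) (lemma (i ℤ./ℕ 2)))
  where
  lemma : ∀ k → 1ℤ + k * + 2 + 1ℤ ≡ (1ℤ + k) * + 2
  lemma = solve-∀
... | ℕ.suc (ℕ.suc _) | eq | s≤s (s≤s ())

odd⇒even-1 : ∀ {i} → ¬ Even i → Even (i + ℤ.-1ℤ)
odd⇒even-1 {i} odd = subst Even (lemma i) (ℤ.∣m∣n⇒∣m-n (odd⇒even+1 odd) ℤ.∣-refl)
  where
  lemma : ∀ i → i + 1ℤ - + 2 ≡ i + ℤ.-1ℤ
  lemma = solve-∀

¬Even-double+1 : ∀ i → ¬ Even (i + i + 1ℤ)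
¬Even-double+1 i ev = contradiction (ℕ.∣1⇒≡1 (ℤ.∣⇒∣ᵤ 2∣1)) λ ()
  where
  double : ∀ i → i + i ≡ i * + 2
  double = solve-∀

  2∣1 : Even 1ℤ
  2∣1 = ℤ.∣m+n∣m⇒∣n ev (divides i (double i))

-- Kronecker delta and signs as units.

opaque
  δ : ∀ {n} → Fin n → Fin n → ℤ
  δ i j = if does (i Fin.≟ j) then 1ℤ else 0ℤ

  δ-refl : ∀ {n} (i : Fin n) → δ i i ≡ 1ℤ
  δ-refl i with i Fin.≟ i
  ... | yes _   = refl
  ... | no  i≢i = contradiction refl i≢i

  δ-distinct : ∀ {n} {i j : Fin n} → i ≢ j → δ i j ≡ 0ℤ
  δ-distinct {i = i} {j} i≢j with i Fin.≟ j
  ... | yes i≡j = contradiction i≡j i≢j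
  ... | no  _   = refl

  δ-suc : ∀ {n} (i j : Fin n) → δ (suc i) (suc j) ≡ δ i j
  δ-suc i j with i Fin.≟ j
  ... | yes _ = refl
  ... | no  _ = refl

  sum-δ : ∀ {n} (t : Fin n → ℤ) i → sum (λ j → t j * δ i j) ≡ t i
  sum-δ {ℕ.suc n} t zero = begin
    t zero * 1ℤ + sum (λ j → t (suc j) * 0ℤ)
      ≡⟨ cong₂ _+_ (ℤ.*-identityʳ (t zero)) (trans (sum-cong-≗ (λ j → ℤ.*-zeroʳ (t (suc j)))) (sum-replicate-zero n)) ⟩
    t zero + 0ℤ
      ≡⟨ ℤ.+-identityʳ _ ⟩
    t zero ∎
    where open ≡-Reasoning
  sum-δ {ℕ.suc n} t (suc i) = begin
    t zero * 0ℤ + sum (λ j → t (suc j) * δ (suc i) (suc j))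
      ≡⟨ cong₂ _+_ (ℤ.*-zeroʳ (t zero)) (sum-cong-≗ (λ j → cong (t (suc j) *_) (δ-suc i j))) ⟩
    0ℤ + sum (λ j → t (suc j) * δ i j)
      ≡⟨ trans (ℤ.+-identityˡ _) (sum-δ (t ∘ suc) i) ⟩
    t (suc i) ∎
    where open ≡-Reasoning

⟦_⟧ : Sign → ℤ
⟦ Sign.+ ⟧ = 1ℤ
⟦ Sign.- ⟧ = ℤ.-1ℤ

-- Net inflow.

module Incidence (G : Digraph) where
  open Digraph G

  -- Entry of the signed incidence matrix; a loop has a zero column.
  ι : Fin #V → Fin #E → ℤ
  ι v e = δ (target e) v - δ (source e) v

  ∂ : (Fin #E → ℤ) → Fin #V → ℤ
  ∂ f v = sum (λ e → ι v e * f e)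

  ∂-cong : ∀ {f g} → (∀ e → f e ≡ g e) → ∀ v → ∂ f v ≡ ∂ g v
  ∂-cong f≗g v = sum-cong-≗ (λ e → cong (ι v e *_) (f≗g e))

  ∂-+ : ∀ f g v → ∂ (λ e → f e + g e) v ≡ ∂ f v + ∂ g v
  ∂-+ f g v = trans (sum-cong-≗ (λ e → ℤ.*-distribˡ-+ (ι v e) (f e) (g e))) (∑-distrib-+ (λ e → ι v e * f e) (λ e → ι v e * g e))

  ∂-neg : ∀ f v → ∂ (λ e → - f e) v ≡ - ∂ f v
  ∂-neg f v = trans (sum-cong-≗ (λ e → sym (ℤ.neg-distribʳ-* (ι v e) (f e)))) (sum-neg (λ e → ι v e * f e))

  ∂-- : ∀ f g v → ∂ (λ e → f e - g e) v ≡ ∂ f v - ∂ g v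
  ∂-- f g v = trans (∂-+ f _ v) (cong (λ i → ∂ f v + i) (∂-neg g v))

  opaque
    unfolding δ

    inflow-outflow : ∀ f v → inflow G f v - outflow G f v ≡ ∂ (lookup f) v
    inflow-outflow f v = begin
      inflow G f v - outflow G f v  ≡⟨ cong (λ i → inflow G f v + i) (sum-neg out) ⟨
      inflow G f v + sum (-_ ∘ out) ≡⟨ ∑-distrib-+ into (-_ ∘ out) ⟨
      sum (λ e → into e - out e)     ≡⟨ sum-cong-≗ term ⟩
      ∂ (lookup f) v                ∎
      where
      open ≡-Reasoning

      into out : Fin #E → ℤ
      into e = if does (target e Fin.≟ v) then lookup f e else 0ℤ
      out e = if does (source e Fin.≟ v) then lookup f e else 0ℤ

      term : ∀ e → into e - out e ≡ ι v e * lookup f e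
      term e with does (target e Fin.≟ v) | does (source e Fin.≟ v)
      ... | true  | true  = ℤ.+-inverseʳ (lookup f e)
      ... | true  | false = trans (ℤ.+-identityʳ _) (sym (ℤ.*-identityˡ _))
      ... | false | true  = trans (ℤ.+-identityˡ _) (sym (ℤ.-1*i≡-i _))
      ... | false | false = refl

  -- Pushing a unit along an oriented edge.

  -- An edge with a direction of traversal; traversing it backwards lowers its flow by one.
  Dart : Set
  Dart = Fin #E × Sign

  head tail : Dart → Fin #V
  head (e , Sign.+) = target e
  head (e , Sign.-) = source e
  tail (e , Sign.+) = source e
  tail (e , Sign.-) = target e

  reverse : Dart → Dart
  reverse (e , σ) = e , Sign.opposite σ

  opaque
    unit : Dart → Fin #E → ℤ
    unit (e , σ) e′ = δ e e′ * ⟦ σ ⟧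

    unit-refl : ∀ e σ → unit (e , σ) e ≡ ⟦ σ ⟧
    unit-refl e σ = trans (cong (_* ⟦ σ ⟧) (δ-refl e)) (ℤ.*-identityˡ _)

    unit-off : ∀ {e e′} σ → e ≢ e′ → unit (e , σ) e′ ≡ 0ℤ
    unit-off σ e≢e′ = cong (_* ⟦ σ ⟧) (δ-distinct e≢e′)

    unit-reverse : ∀ D e → unit (reverse D) e ≡ - unit D e
    unit-reverse (e , Sign.+) e′ = sym (ℤ.neg-distribʳ-* (δ e e′) 1ℤ)
    unit-reverse (e , Sign.-) e′ = sym (ℤ.neg-distribʳ-* (δ e e′) ℤ.-1ℤ)

    ∂-unit : ∀ D v → ∂ (unit D) v ≡ δ (head D) v - δ (tail D) v
    ∂-unit (e , σ) v = trans total (ends σ)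
      where
      open ≡-Reasoning

      shuffle : ∀ a b c → a * (b * c) ≡ a * c * b
      shuffle = solve-∀

      total : ∂ (unit (e , σ)) v ≡ ι v e * ⟦ σ ⟧
      total = trans (sum-cong-≗ (λ e′ → shuffle (ι v e′) (δ e e′) ⟦ σ ⟧)) (sum-δ (λ e′ → ι v e′ * ⟦ σ ⟧) e)

      flip-- : ∀ a b → (a - b) * ℤ.-1ℤ ≡ b - a
      flip-- = solve-∀

      ends : ∀ σ → ι v e * ⟦ σ ⟧ ≡ δ (head (e , σ)) v - δ (tail (e , σ)) v
      ends Sign.+ = ℤ.*-identityʳ _
      ends Sign.- = flip-- (δ (target e) v) (δ (source e) v)

  push : (Fin #E → ℤ) → Dart → Fin #E → ℤ
  push f D e = f e + unit D e

  ∂-push : ∀ f D v → ∂ (push f D) v ≡ ∂ f v + (δ (head D) v - δ (tail D) v)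
  ∂-push f D v = trans (∂-+ f (unit D) v) (cong (λ i → ∂ f v + i) (∂-unit D v))

  -- A push alters the value at `e` alone, so a pointwise claim needs a separate check only there.
  push-elim : ∀ {q} (Q : Fin #E → ℤ → Set q) f e σ → Q e (f e + ⟦ σ ⟧) → (∀ e′ → Q e′ (f e′)) →
              ∀ e′ → Q e′ (push f (e , σ) e′)
  push-elim Q f e σ Qe Qf e′ = go e′ (e Fin.≟ e′)
    where
    go : ∀ e′ → Dec (e ≡ e′) → Q e′ (push f (e , σ) e′)
    go e′ (yes refl) = subst (λ i → Q e (f e + i)) (sym (unit-refl e σ)) Qe
    go e′ (no  e≢e′) = subst (Q e′) (sym (trans (cong (λ i → f e′ + i) (unit-off σ e≢e′)) (ℤ.+-identityʳ _))) (Qf e′)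

  -- Makes both kinds of walk terminate: `m` is the oddity of an edge in one and the distance to a
  -- target flow in the other.
  push-sum-< : ∀ (m : Fin #E → ℤ → ℕ) f e σ → m e (f e + ⟦ σ ⟧) ℕ.< m e (f e) →
               ℕΣ.sum (λ e′ → m e′ (push f (e , σ) e′)) ℕ.< ℕΣ.sum (λ e′ → m e′ (f e′))
  push-sum-< m f e σ lt = sum-mono-<
    {s = λ e′ → m e′ (push f (e , σ) e′)} {t = λ e′ → m e′ (f e′)}
    (push-elim (λ e′ i → m e′ i ℕ.≤ m e′ (f e′)) f e σ (ℕ.<⇒≤ lt) (λ _ → ℕ.≤-refl)) e
    (subst (λ i → m e (f e + i) ℕ.< m e (f e)) (sym (unit-refl e σ)) lt)

  opaque
    unfolding δ

    -- Some edge contributes a term outside `P` to the net inflow at `v`; loops and edges away from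
    -- `v` contribute 0 and are ruled out by `P0`. The dart is oriented to leave `v`, whence the
    -- sign of its contribution.
    ∃-dart : ∀ {p} {P : Pred ℤ p} → Decidable P → P 0ℤ → (∀ {i j} → P i → P j → P (i + j)) →
             ∀ f v → ¬ P (∂ f v) → ∃₂ λ e σ → tail (e , σ) ≡ v × ¬ P (- (⟦ σ ⟧ * f e))
    ∃-dart {P = P} P? P0 P+ f v ¬P with ∃-summand P? P0 P+ _ ¬P
    ... | e , ¬Pe with target e Fin.≟ v | source e Fin.≟ v
    ...   | yes t≡v | yes _   = contradiction (subst P (sym (ℤ.*-zeroˡ (f e))) P0) ¬Pe
    ...   | yes t≡v | no  _   = e , Sign.- , t≡v , ¬Pe ∘ subst P (lemma (f e))
      where
      lemma : ∀ i → - (ℤ.-1ℤ * i) ≡ 1ℤ * i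
      lemma = solve-∀
    ...   | no  _   | yes s≡v = e , Sign.+ , s≡v , ¬Pe ∘ subst P (lemma (f e))
      where
      lemma : ∀ i → - (1ℤ * i) ≡ ℤ.-1ℤ * i
      lemma = solve-∀
    ...   | no  _   | no  _   = contradiction (subst P (sym (ℤ.*-zeroˡ (f e))) P0) ¬Pe

  -- Rounding half of an integral flow.

  -- Twice `p` differs from `c` by at most one, so `p` is half of `c` rounded up or down.
  Half : ℤ → ℤ → Set
  Half p c = c ℤ.≤ p + p + 1ℤ × p + p ℤ.≤ c + 1ℤ

  opaque
    oddity : ℤ → ℕ
    oddity i = if does (even? i) then 0 else 1

    oddity-even : ∀ {i} → Even i → oddity i ≡ 0
    oddity-even {i} even = cong (if_then 0 else 1) (dec-true (even? i) even)

    oddity-odd : ∀ {i} → ¬ Even i → oddity i ≡ 1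
    oddity-odd {i} odd = cong (if_then 0 else 1) (dec-false (even? i) odd)

  odd⇒even+sign : ∀ σ {i} → ¬ Even i → Even (i + ⟦ σ ⟧)
  odd⇒even+sign Sign.+ = odd⇒even+1
  odd⇒even+sign Sign.- = odd⇒even-1

  half-exact : ∀ {p c} → Even c → Half p c → p + p ≡ c
  half-exact {p} (divides k refl) (c≤ , ≤c) = trans (cong₂ _+_ p≡k p≡k) (double k)
    where
    double : ∀ k → k + k ≡ k * + 2
    double = solve-∀

    p≡k : p ≡ k
    p≡k = ℤ.≤-antisym
      (halve-≤ (ℤ.≤-trans ≤c (ℤ.≤-reflexive (cong (_+ 1ℤ) (sym (double k))))))
      (halve-≤ (ℤ.≤-trans (ℤ.≤-reflexive (double k)) c≤))

  -- The pushed value is even, so `p + p` equals it exactly, and it lies at distance one from `c`.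
  half-unpush : ∀ {p c} σ → ¬ Even c → Half p (c + ⟦ σ ⟧) → Half p c
  half-unpush {p} {c} σ odd h with half-exact {p} (odd⇒even+sign σ odd) h
  ... | eq rewrite eq = up σ , down σ
    where
    cancel+ : ∀ c → c + 1ℤ + 1ℤ ≡ c + + 2
    cancel+ = solve-∀
    cancel- : ∀ c → c + ℤ.-1ℤ + 1ℤ ≡ c
    cancel- = solve-∀
    up : ∀ σ → c ℤ.≤ c + ⟦ σ ⟧ + 1ℤ
    up Sign.+ = ℤ.≤-trans (ℤ.i≤i+j c (+ 2)) (ℤ.≤-reflexive (sym (cancel+ c)))
    up Sign.- = ℤ.≤-reflexive (sym (cancel- c))
    down : ∀ σ → c + ⟦ σ ⟧ ℤ.≤ c + 1ℤ
    down Sign.+ = ℤ.≤-refl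
    down Sign.- = ℤ.+-monoʳ-≤ c ℤ.-≤+

  -- Walk along odd edges, making each of them even by a unit: ∂ c is odd at the
  -- end x of the walk as long as x ≢ v, so another odd edge leaves x.
  round : ∀ (d : Fin #V → ℤ) c x v → Acc ℕ._<_ (ℕΣ.sum (λ e → oddity (c e))) →
          (∀ y → ∂ c y ≡ d y + d y + δ x y - δ v y) →
          ∃ λ p → (∀ e → Half (p e) (c e)) × (∀ y → ∂ p y ≡ d y)
  round d c x v (acc rec) ∂c = go (x Fin.≟ v) (Fin.any? (λ e → ¬? (even? (c e))))
    where
    Goal : Set
    Goal = ∃ λ p → (∀ e → Half (p e) (c e)) × (∀ y → ∂ p y ≡ d y)

    step : ∀ e σ w → ¬ Even (c e) → (∀ y → ∂ c y ≡ d y + d y + δ (tail (e , σ)) y - δ w y) → Goal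
    -- The push carries the surplus unit from the tail to the head of the dart, while the deficit
    -- stays at `w`.
    step e σ w odd ∂c = conclude (round d (push c D) (head D) w (rec fewer) ∂c′)
      where
      D = e , σ

      on< : oddity (c e + ⟦ σ ⟧) ℕ.< oddity (c e)
      on< = subst₂ ℕ._<_ (sym (oddity-even (odd⇒even+sign σ odd))) (sym (oddity-odd odd)) (s≤s z≤n)

      fewer : ℕΣ.sum (λ e → oddity (push c D e)) ℕ.< ℕΣ.sum (λ e → oddity (c e))
      fewer = push-sum-< (λ _ → oddity) c e σ on<

      lemma : ∀ a t w h → a + t - w + (h - t) ≡ a + h - w
      lemma = solve-∀

      ∂c′ : ∀ y → ∂ (push c D) y ≡ d y + d y + δ (head D) y - δ w y
      ∂c′ y = trans (∂-push c D y) (trans (cong (_+ (δ (head D) y - δ (tail D) y)) (∂c y))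
                (lemma (d y + d y) (δ (tail D) y) (δ w y) (δ (head D) y)))

      conclude : (∃ λ p → (∀ e → Half (p e) (push c D e)) × (∀ y → ∂ p y ≡ d y)) → Goal
      conclude (p , half , ∂p) = p , (λ e′ → unpush e′ (half e′)) , ∂p
        where
        unpush : ∀ e′ → Half (p e′) (push c D e′) → Half (p e′) (c e′)
        unpush = push-elim (λ e′ i → Half (p e′) i → Half (p e′) (c e′)) c e σ (half-unpush {p e} σ odd) (λ _ h → h)

    odd-at-end : x ≢ v → ¬ Even (∂ c x)
    odd-at-end x≢v ev = ¬Even-double+1 (d x) (subst Even (trans (∂c x)
      (trans (cong₂ (λ i j → d x + d x + i - j) (δ-refl x) (δ-distinct (x≢v ∘ sym))) (lemma (d x + d x)))) ev)
      where
      lemma : ∀ a → a + 1ℤ - 0ℤ ≡ a + 1ℤ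
      lemma = solve-∀

    from-end : (∃₂ λ e σ → tail (e , σ) ≡ x × ¬ Even (- (⟦ σ ⟧ * c e))) → Goal
    from-end (e , σ , refl , odd) = step e σ v (λ even → odd (ℤ.∣m⇒∣-m (ℤ.∣n⇒∣m*n ⟦ σ ⟧ even))) ∂c

    from-anywhere : x ≡ v → ∀ e → ¬ Even (c e) → Goal
    -- Once the walk has closed up, surplus and deficit cancel, so both may be relocated to the
    -- source of any odd edge, where another walk starts.
    from-anywhere refl e odd = step e Sign.+ (source e) odd λ y →
      trans (∂c y) (lemma (d y + d y) (δ x y) (δ (source e) y))
      where
      lemma : ∀ a b c → a + b - b ≡ a + c - c
      lemma = solve-∀

    finish : x ≡ v → (∀ e → Even (c e)) → Goal
    -- Every edge is even and the surplus has cancelled, so exact halves exist and their doubled net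
    -- inflow is twice the demand.
    finish refl even = p , half , λ y →
      halves-equal (trans (sym (∂-+ p p y)) (trans (∂-cong p+p≗c y) (trans (∂c y) (lemma (d y + d y) (δ x y)))))
      where
      p : Fin #E → ℤ
      p e = ℤ._∣_.quotient (even e)

      double : ∀ k → k + k ≡ k * + 2
      double = solve-∀

      p+p≗c : ∀ e → p e + p e ≡ c e
      p+p≗c e = trans (double (p e)) (sym (ℤ._∣_.equality (even e)))

      half : ∀ e → Half (p e) (c e)
      half e = subst (λ i → c e ℤ.≤ i + 1ℤ × i ℤ.≤ c e + 1ℤ) (sym (p+p≗c e))
        (ℤ.i≤i+j (c e) 1ℤ , ℤ.i≤i+j (c e) 1ℤ)

      lemma : ∀ a b → a + b - b ≡ a
      lemma = solve-∀

      halves-equal : ∀ {i j} → i + i ≡ j + j → i ≡ j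
      halves-equal {i} {j} eq = ℤ.≤-antisym
        (halve-≤ (ℤ.≤-trans (ℤ.≤-reflexive eq) (ℤ.i≤i+j (j + j) 1ℤ)))
        (halve-≤ (ℤ.≤-trans (ℤ.≤-reflexive (sym eq)) (ℤ.i≤i+j (i + i) 1ℤ)))

    go : Dec (x ≡ v) → Dec (∃ λ e → ¬ Even (c e)) → Goal
    go (no  x≢v) _               = from-end (∃-dart even? (divides 0ℤ refl) ℤ.∣m∣n⇒∣m+n c x (odd-at-end x≢v))
    go (yes x≡v) (yes (e , odd)) = from-anywhere x≡v e odd
    go (yes x≡v) (no ¬odd)       = finish x≡v (λ e → decidable-stable (even? (c e)) (λ odd → ¬odd (e , odd)))

-- Unit moves toward a target.

i+j-j≡i : ∀ i j → i + j - j ≡ i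
i+j-j≡i = solve-∀

i-j<0⇒i<j : ∀ {i j} → i - j ℤ.< 0ℤ → i ℤ.< j
i-j<0⇒i<j lt = ℤ.≰⇒> λ j≤i → ℤ.<⇒≱ lt (ℤ.i≤j⇒0≤j-i j≤i)

toward-0-shrinks : ∀ σ {i} → ⟦ σ ⟧ * i ℤ.< 0ℤ → ∣ i + ⟦ σ ⟧ ∣ ℕ.< ∣ i ∣
toward-0-shrinks Sign.+ {+ n}          lt = contradiction (subst (ℤ._< 0ℤ) (ℤ.*-identityˡ (+ n)) lt) λ { (ℤ.+<+ ()) }
toward-0-shrinks Sign.+ { -[1+ ℕ.zero ]}  lt = s≤s z≤n
toward-0-shrinks Sign.+ { -[1+ ℕ.suc n ]} lt = ℕ.≤-refl
toward-0-shrinks Sign.- {+ ℕ.zero}     (ℤ.+<+ ())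
toward-0-shrinks Sign.- {+ ℕ.suc n}    lt = ℕ.≤-refl
toward-0-shrinks Sign.- { -[1+ n ]}    lt = contradiction (subst (ℤ._< 0ℤ) (ℤ.-1*i≡-i -[1+ n ]) lt) λ { (ℤ.+<+ ()) }

⟦⟧-opposite : ∀ σ i → ⟦ Sign.opposite σ ⟧ * i ≡ - (⟦ σ ⟧ * i)
⟦⟧-opposite Sign.+ i = trans (ℤ.-1*i≡-i i) (cong -_ (sym (ℤ.*-identityˡ i)))
⟦⟧-opposite Sign.- i = trans (ℤ.*-identityˡ i) (trans (sym (ℤ.neg-involutive i)) (cong -_ (sym (ℤ.-1*i≡-i i))))

≢⇒sign : ∀ {i} → i ≢ 0ℤ → ∃ λ σ → ⟦ σ ⟧ * i ℤ.< 0ℤ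
≢⇒sign {+ ℕ.zero}  i≢0 = contradiction refl i≢0
≢⇒sign {+ ℕ.suc n} i≢0 = Sign.- , ℤ.-<+
≢⇒sign { -[1+ n ]} i≢0 = Sign.+ , ℤ.-<+

-- Multiplying by the sign treats both directions at once: for a positive `σ` this is `i < j`, for a
-- negative one `j < i`.
Toward : Sign → ℤ → ℤ → Set
Toward σ i j = ⟦ σ ⟧ * (i - j) ℤ.< 0ℤ

toward? : ∀ σ i j → Dec (Toward σ i j)
toward? σ i j = ⟦ σ ⟧ * (i - j) ℤ.<? 0ℤ

-- Signed differences add up, so a negative total with a nonnegative first part leaves a negative
-- remainder.
toward-+ : ∀ σ {i j} k l → Toward σ (k + i) (l + j) → ¬ Toward σ k l → Toward σ i j
toward-+ σ {i} {j} k l lt ¬lt = ℤ.≰⇒> λ 0≤ → ℤ.<⇒≱ lt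
  (ℤ.≤-trans (ℤ.+-mono-≤ (ℤ.≮⇒≥ ¬lt) 0≤) (ℤ.≤-reflexive (lemma ⟦ σ ⟧ k l i j)))
  where
  lemma : ∀ s k l i j → s * (k - l) + s * (i - j) ≡ s * (k + i - (l + j))
  lemma = solve-∀

-- Equal sums make the two differences negatives of each other.
toward-opposite : ∀ σ {i j k l} → i + k ≡ j + l → Toward σ i j → Toward (Sign.opposite σ) k l
toward-opposite σ {i} {j} {k} {l} eq = subst (ℤ._< 0ℤ) (begin
  ⟦ σ ⟧ * (i - j)                ≡⟨ cong (⟦ σ ⟧ *_) (lemma i j k) ⟩
  ⟦ σ ⟧ * (i + k - (j + k))      ≡⟨ cong (λ n → ⟦ σ ⟧ * (n - (j + k))) eq ⟩
  ⟦ σ ⟧ * (j + l - (j + k))      ≡⟨ lemma′ ⟦ σ ⟧ j k l ⟩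
  - (⟦ σ ⟧ * (k - l))            ≡⟨ ⟦⟧-opposite σ (k - l) ⟨
  ⟦ Sign.opposite σ ⟧ * (k - l) ∎)
  where
  open ≡-Reasoning
  lemma : ∀ i j k → i - j ≡ i + k - (j + k)
  lemma = solve-∀
  lemma′ : ∀ s j k l → s * (j + l - (j + k)) ≡ - (s * (k - l))
  lemma′ = solve-∀

module _ {p} {P : Pred ℤ p} (convex : ∀ {i j k} → P i → P k → i ℤ.≤ j → j ℤ.≤ k → P j) where

  -- A unit step in the direction of `j` cannot overshoot it, so the result lies between `i` and
  -- `j`.
  convex-toward : ∀ σ {i j} → Toward σ i j → P i → P j → P (i + ⟦ σ ⟧)
  convex-toward Sign.+ {i} {j} lt Pi Pj = convex Pi Pj (ℤ.i≤i+j i 1ℤ)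
    (ℤ.≤-trans (ℤ.≤-reflexive (ℤ.+-comm i 1ℤ)) (ℤ.i<j⇒suc[i]≤j (i-j<0⇒i<j {i} {j} (subst (ℤ._< 0ℤ) (ℤ.*-identityˡ (i - j)) lt))))
  convex-toward Sign.- {i} {j} lt Pi Pj = convex Pj Pi
    (ℤ.≤-trans (ℤ.i<j⇒i≤pred[j] (i-j<0⇒i<j (subst (ℤ._< 0ℤ) (lemma i j) lt))) (ℤ.≤-reflexive (ℤ.+-comm ℤ.-1ℤ i)))
    (ℤ.i-j≤i i 1ℤ)
    where
    lemma : ∀ i j → ℤ.-1ℤ * (i - j) ≡ j - i
    lemma = solve-∀


-- Feasible flows and their splitting.

module Flows (G : Digraph) (d : Vec ℤ (Digraph.#V G)) (u l : Vec ℤ (Digraph.#E G)) where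
  open Digraph G
  open Incidence G

  Point : Set
  Point = Refinement (Vec ℤ #E) (FlowPolytopePoint G d u l)

  infix 9 _⟨_⟩
  _⟨_⟩ : Point → Fin #E → ℤ
  p ⟨ e ⟩ = lookup (value p) e

  -- The constraints of a single edge, kept apart from conservation so that a row with a defect can
  -- still be required to respect the bounds.
  Allowed : Fin #E → ℤ → Set
  Allowed e n = 0ℤ ℤ.≤ n × lookup l e ℤ.≤ n × n ℤ.≤ lookup u e

  allowed-convex : ∀ {e i j k} → Allowed e i → Allowed e k → i ℤ.≤ j → j ℤ.≤ k → Allowed e j
  allowed-convex (0≤i , l≤i , _) (_ , _ , k≤u) i≤j j≤k =
    ℤ.≤-trans 0≤i i≤j , ℤ.≤-trans l≤i i≤j , ℤ.≤-trans j≤k k≤u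

  -- The sum obeys the doubled bounds, and `halve-≤` absorbs the rounding error.
  allowed-half : ∀ {e i j k} → Allowed e i → Allowed e j → Half k (i + j) → Allowed e k
  allowed-half (0≤i , l≤i , i≤u) (0≤j , l≤j , j≤u) (≤2k , 2k≤) =
    halve-≤ (ℤ.≤-trans (ℤ.+-mono-≤ 0≤i 0≤j) ≤2k) ,
    halve-≤ (ℤ.≤-trans (ℤ.+-mono-≤ l≤i l≤j) ≤2k) ,
    halve-≤ (ℤ.≤-trans 2k≤ (ℤ.+-monoˡ-≤ 1ℤ (ℤ.+-mono-≤ i≤u j≤u)))

  -- Passing to `c - k` only reverses the sign of `c - (k + k)`, which `Half` bounds on both sides.
  half-complement : ∀ k c → Half k c → Half (c - k) c
  half-complement k c (c≤ , ≤c) =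
    ℤ.≤-trans (ℤ.≤-reflexive (eq₁ k c)) (ℤ.≤-trans (ℤ.+-monoʳ-≤ (c - (k + k)) ≤c) (ℤ.≤-reflexive (eq₂ k c))) ,
    ℤ.≤-trans (ℤ.≤-reflexive (eq₃ k c)) (ℤ.≤-trans (ℤ.+-monoˡ-≤ (c - (k + k)) c≤) (ℤ.≤-reflexive (eq₄ k c)))
    where
    eq₁ : ∀ k c → c ≡ c - (k + k) + (k + k)
    eq₁ = solve-∀
    eq₂ : ∀ k c → c - (k + k) + (c + 1ℤ) ≡ c - k + (c - k) + 1ℤ
    eq₂ = solve-∀
    eq₃ : ∀ k c → c - k + (c - k) ≡ c + (c - (k + k))
    eq₃ = solve-∀
    eq₄ : ∀ k c → k + k + 1ℤ + (c - (k + k)) ≡ c + 1ℤ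
    eq₄ = solve-∀

  -- The membership proof of a point is irrelevant, but each inequality is decidable and can be
  -- recomputed.
  point-allowed : ∀ p e → Allowed e (p ⟨ e ⟩)
  point-allowed (f , [ flow ]) e =
    recompute (_ ℤ.≤? _) (FlowPolytopePoint.nonNegative flow e) ,
    recompute (_ ℤ.≤? _) (FlowPolytopePoint.lower flow e) ,
    recompute (_ ℤ.≤? _) (FlowPolytopePoint.upper flow e)

  point-∂ : ∀ p v → ∂ (p ⟨_⟩) v ≡ lookup d v
  point-∂ (f , [ flow ]) v =
    trans (sym (inflow-outflow f v)) (recompute (_ ℤ.≟ _) (FlowPolytopePoint.conservation flow v))

  ∃-point : ∀ f → (∀ e → Allowed e (f e)) → (∀ v → ∂ f v ≡ lookup d v) → ∃ λ p → ∀ e → p ⟨ e ⟩ ≡ f e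
  ∃-point f allowed ∂f = (tabulate f , [ flow ]) , f̂≗f
    where
    f̂≗f : ∀ e → lookup (tabulate f) e ≡ f e
    f̂≗f = lookup∘tabulate f

    flow : FlowPolytopePoint G d u l (tabulate f)
    flow = record
      { nonNegative  = λ e → subst (0ℤ ℤ.≤_) (sym (f̂≗f e)) (proj₁ (allowed e))
      ; conservation = λ v → trans (inflow-outflow (tabulate f) v) (trans (∂-cong f̂≗f v) (∂f v))
      ; lower        = λ e → subst (lookup l e ℤ.≤_) (sym (f̂≗f e)) (proj₁ (proj₂ (allowed e)))
      ; upper        = λ e → subst (ℤ._≤ lookup u e) (sym (f̂≗f e)) (proj₂ (proj₂ (allowed e)))
      }

  -- Rounding half of `a + b` yields a flow with exactly the demand, so the complementary half `c`
  -- inherits the whole defect. Both halves respect the bounds because `a` and `b` do.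
  split : ∀ a b x w → (∀ e → Allowed e (a e)) → (∀ e → Allowed e (b e)) →
          (∀ y → ∂ a y + ∂ b y ≡ lookup d y + lookup d y + δ x y - δ w y) →
          ∃₂ λ p c → (∀ e → p ⟨ e ⟩ + c e ≡ a e + b e) × (∀ e → Allowed e (c e)) ×
                     (∀ y → ∂ c y ≡ lookup d y + δ x y - δ w y)
  split a b x w a-ok b-ok ∂ab
    with p , half , ∂p ← round (lookup d) (λ e → a e + b e) x w (<-wellFounded _) (λ y → trans (∂-+ a b y) (∂ab y))
    with p̂ , p̂≗p ← ∃-point p (λ e → allowed-half (a-ok e) (b-ok e) (half e)) ∂p
    = p̂ , (λ e → a e + b e - p e) ,
      (λ e → trans (cong (_+ (a e + b e - p e)) (p̂≗p e)) (lemma (p e) (a e + b e))) ,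
      (λ e → allowed-half (a-ok e) (b-ok e) (half-complement (p e) (a e + b e) (half e))) ,
      λ y → begin
        ∂ (λ e → a e + b e - p e) y                                ≡⟨ ∂-- (λ e → a e + b e) p y ⟩
        ∂ (λ e → a e + b e) y - ∂ p y                              ≡⟨ cong₂ _-_ (trans (∂-+ a b y) (∂ab y)) (∂p y) ⟩
        lookup d y + lookup d y + δ x y - δ w y - lookup d y       ≡⟨ lemma′ (lookup d y) (δ x y) (δ w y) ⟩
        lookup d y + δ x y - δ w y                                 ∎
    where
    open ≡-Reasoning
    lemma : ∀ p c → p + (c - p) ≡ c
    lemma = solve-∀
    lemma′ : ∀ d x w → d + d + x - w - d ≡ d + x - w
    lemma′ = solve-∀

  -- Sums of lists of flows, and exchanges.

  total : List Point → Fin #E → ℤ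
  total []       e = 0ℤ
  total (p ∷ ps) e = p ⟨ e ⟩ + total ps e

  total-↭ : ∀ {ps qs} → ps ↭ qs → ∀ e → total ps e ≡ total qs e
  total-↭ _↭_.refl        e = refl
  total-↭ (prep p ps↭qs)  e = cong (λ i → p ⟨ e ⟩ + i) (total-↭ ps↭qs e)
  total-↭ (swap {ys = qs} p q ps↭qs) e =
    trans (cong (λ i → p ⟨ e ⟩ + (q ⟨ e ⟩ + i)) (total-↭ ps↭qs e)) (lemma (p ⟨ e ⟩) (q ⟨ e ⟩) (total qs e))
    where
    lemma : ∀ p q r → p + (q + r) ≡ q + (p + r)
    lemma = solve-∀
  total-↭ (_↭_.trans ps↭qs qs↭rs) e = trans (total-↭ ps↭qs e) (total-↭ qs↭rs e)

  infix  4 _⇝_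
  infixr 5 _then_

  -- Each move has an algebraic counterpart: an exchange beside `rs` is a monomial multiple of a
  -- binomial of degree at most three, and `_then_` is a telescoping sum.
  data _⇝_ : List Point → List Point → Set where
    permute  : ∀ {ps qs} → ps ↭ qs → ps ⇝ qs
    exchange : ∀ {ps qs} rs → length ps ℕ.≤ 3 → length qs ℕ.≤ 3 →
               (∀ e → total ps e ≡ total qs e) → ps ++ rs ⇝ qs ++ rs
    _then_   : ∀ {ps qs rs} → ps ⇝ qs → qs ⇝ rs → ps ⇝ rs

  ⇝-prep : ∀ p {ps qs} → ps ⇝ qs → p ∷ ps ⇝ p ∷ qs
  ⇝-prep p (permute ps↭qs) = permute (prep p ps↭qs)
  ⇝-prep p (exchange {ps} {qs} rs ps≤3 qs≤3 eq) =
    permute (↭-sym (shift p ps rs)) then exchange (p ∷ rs) ps≤3 qs≤3 eq then permute (shift p qs rs)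
  ⇝-prep p (ps⇝qs then qs⇝rs) = ⇝-prep p ps⇝qs then ⇝-prep p qs⇝rs

  -- Pair the rows in order: if no pair lay in direction `σ`, neither would the totals. The partner
  -- `b` certifies that `r` has room to move by one unit.
  find-toward : ∀ σ e rs bs → length rs ≡ length bs → Toward σ (total rs e) (total bs e) →
                ∃₂ λ r rs′ → ∃ λ b → rs ↭ r ∷ rs′ × Toward σ (r ⟨ e ⟩) (b ⟨ e ⟩)
  find-toward σ e []       []       len t = contradiction (subst (ℤ._< 0ℤ) (ℤ.*-zeroʳ ⟦ σ ⟧) t) (ℤ.<-irrefl refl)
  find-toward σ e (r ∷ rs) (b ∷ bs) len t with toward? σ (r ⟨ e ⟩) (b ⟨ e ⟩)
  ... | yes t′ = r , rs , b , ↭-refl , t′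
  ... | no ¬t′
    with r′ , rs′ , b′ , rs↭ , t″ ← find-toward σ e rs bs (ℕ.suc-injective len) (toward-+ σ (r ⟨ e ⟩) (b ⟨ e ⟩) t ¬t′)
    = r′ , r ∷ rs′ , b′ , ↭-trans (prep r rs↭) (swap r r′ ↭-refl) , t″

  -- Turning one flow of a list into a prescribed flow.

  module _ (g b : Point) (bs : List Point)
    (IH : ∀ ps → length ps ≡ length (b ∷ bs) → (∀ e → total ps e ≡ total (b ∷ bs) e) → ps ⇝ b ∷ bs)
    where

    distance : (Fin #E → ℤ) → ℕ
    distance f = ℕΣ.sum (λ e → ∣ f e - g ⟨ e ⟩ ∣)

    -- The row h carries the defect opposite to that of f; p and q are arbitrary
    -- proper flows standing in for the improper pair f, h.
    approach : ∀ f h rest p q x v → Acc ℕ._<_ (distance f) →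
      (∀ e → Allowed e (f e)) → (∀ e → Allowed e (h e)) →
      (∀ y → ∂ f y ≡ lookup d y + δ x y - δ v y) →
      (∀ y → ∂ h y ≡ lookup d y + δ v y - δ x y) →
      (∀ e → p ⟨ e ⟩ + q ⟨ e ⟩ ≡ f e + h e) →
      (∀ e → f e + (h e + total rest e) ≡ g ⟨ e ⟩ + total (b ∷ bs) e) →
      length rest ≡ length bs →
      p ∷ q ∷ rest ⇝ g ∷ b ∷ bs
    approach f h rest p q x v (acc rec) f-ok h-ok ∂f ∂h pq≡fh sums len =
      go (x Fin.≟ v) (Fin.any? (λ e → ¬? (f e - g ⟨ e ⟩ ℤ.≟ 0ℤ)))
      where
      Goal : Set
      Goal = p ∷ q ∷ rest ⇝ g ∷ b ∷ bs

      step : ∀ e σ w → Toward σ (f e) (g ⟨ e ⟩) →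
             (∀ y → ∂ f y ≡ lookup d y + δ (tail (e , σ)) y - δ w y) →
             (∀ y → ∂ h y ≡ lookup d y + δ w y - δ (tail (e , σ)) y) → Goal
      -- The move of `f` toward `g` on `e` is paid for by an opposite move of another row. Since the
      -- sums agree, either `h` can make it, judged against `b`, or some row of `rest` can.
      step e σ w f→g ∂f ∂h = choose (toward? σ̄ (h e) (b ⟨ e ⟩))
        where
        D = e , σ
        σ̄ = Sign.opposite σ
        f′ = push f D

        f′-ok : ∀ e′ → Allowed e′ (f′ e′)
        f′-ok = push-elim Allowed f e σ (convex-toward allowed-convex σ f→g (f-ok e) (point-allowed g e)) f-ok

        ∂f′ : ∀ y → ∂ f′ y ≡ lookup d y + δ (head D) y - δ w y
        ∂f′ y = trans (∂-push f D y) (trans (cong (_+ (δ (head D) y - δ (tail D) y)) (∂f y))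
                  (lemma (lookup d y) (δ (tail D) y) (δ w y) (δ (head D) y)))
          where
          lemma : ∀ d t w h → d + t - w + (h - t) ≡ d + h - w
          lemma = solve-∀

        closer : distance f′ ℕ.< distance f
        closer = push-sum-< (λ e i → ∣ i - g ⟨ e ⟩ ∣) f e σ
          (subst (λ i → ∣ i ∣ ℕ.< ∣ f e - g ⟨ e ⟩ ∣) (lemma (f e) ⟦ σ ⟧ (g ⟨ e ⟩)) (toward-0-shrinks σ f→g))
          where
          lemma : ∀ f s g → f - g + s ≡ f + s - g
          lemma = solve-∀

        h→b : Toward σ̄ (h e + total rest e) (b ⟨ e ⟩ + total bs e)
        h→b = toward-opposite σ {f e} {g ⟨ e ⟩} (sums e) f→g

        ∂-pull : ∀ k y → ∂ (push k (reverse D)) y ≡ ∂ k y + (δ (tail D) y - δ (head D) y)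
        ∂-pull k y = trans (∂-+ k (unit (reverse D)) y) (cong (λ i → ∂ k y + i)
          (trans (∂-cong (unit-reverse D) y) (trans (∂-neg (unit D) y) (trans (cong -_ (∂-unit D y))
            (lemma (δ (tail D) y) (δ (head D) y))))))
          where
          lemma : ∀ t h → - (h - t) ≡ t - h
          lemma = solve-∀

        push-pull : ∀ k e → f′ e + push k (reverse D) e ≡ f e + k e
        push-pull k e = trans (cong (λ i → f′ e + (k e + i)) (unit-reverse D e)) (lemma (f e) (k e) (unit D e))
          where
          lemma : ∀ f k i → f + i + (k + - i) ≡ f + k
          lemma = solve-∀

        partner : Toward σ̄ (h e) (b ⟨ e ⟩) → Goal
        -- `f′ + h′` equals `f + h`, so `p` and `q` still represent the pair and no exchange is
        -- made.
        partner h→b = approach f′ h′ rest p q (head D) w (rec closer) f′-ok h′-ok ∂f′ ∂h′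
          (λ e → trans (pq≡fh e) (sym (push-pull h e)))
          (λ e → trans (sym (ℤ.+-assoc (f′ e) (h′ e) (total rest e)))
                   (trans (cong (_+ total rest e) (push-pull h e)) (trans (ℤ.+-assoc (f e) (h e) (total rest e)) (sums e))))
          len
          where
          h′ = push h (reverse D)

          h′-ok : ∀ e′ → Allowed e′ (h′ e′)
          h′-ok = push-elim Allowed h e σ̄ (convex-toward allowed-convex σ̄ h→b (h-ok e) (point-allowed b e)) h-ok

          ∂h′ : ∀ y → ∂ h′ y ≡ lookup d y + δ w y - δ (head D) y
          ∂h′ y = trans (∂-pull h y) (trans (cong (_+ (δ (tail D) y - δ (head D) y)) (∂h y))
                    (lemma (lookup d y) (δ (tail D) y) (δ w y) (δ (head D) y)))
            where
            lemma : ∀ d t w h → d + w - t + (t - h) ≡ d + w - h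
            lemma = solve-∀

        -- Splitting h + r′ leaves one proper flow s and one row c with all of the
        -- defect, so that p, q, r are exchanged for p′, q′, s with p′ + q′ = f′ + c.
        third : (∃₂ λ r rs → ∃ λ b′ → rest ↭ r ∷ rs × Toward σ̄ (r ⟨ e ⟩) (b′ ⟨ e ⟩)) → Goal
        third (r , rs , b′ , rest↭ , r→b′) =
          after-split (split h r′ w (head D) h-ok r′-ok ∂hr′)
          where
          r′ = push (r ⟨_⟩) (reverse D)

          r′-ok : ∀ e′ → Allowed e′ (r′ e′)
          r′-ok = push-elim Allowed (r ⟨_⟩) e σ̄
            (convex-toward allowed-convex σ̄ r→b′ (point-allowed r e) (point-allowed b′ e)) (point-allowed r)

          ∂hr′ : ∀ y → ∂ h y + ∂ r′ y ≡ lookup d y + lookup d y + δ w y - δ (head D) y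
          ∂hr′ y = trans (cong₂ _+_ (∂h y) (trans (∂-pull (r ⟨_⟩) y) (cong (_+ (δ (tail D) y - δ (head D) y)) (point-∂ r y))))
                     (lemma (lookup d y) (δ (tail D) y) (δ w y) (δ (head D) y))
            where
            lemma : ∀ d t w h → d + w - t + (d + (t - h)) ≡ d + d + w - h
            lemma = solve-∀

          after-split : (∃₂ λ s c → (∀ e → s ⟨ e ⟩ + c e ≡ h e + r′ e) × (∀ e → Allowed e (c e)) ×
                           (∀ y → ∂ c y ≡ lookup d y + δ w y - δ (head D) y)) → Goal
          -- The defects of `f′` and `c` are opposite, so their sum has twice the demand as net
          -- inflow; giving `split` the vertex `w` twice makes both parts proper.
          after-split (s , c , sc≡hr′ , c-ok , ∂c) = resolve (split f′ c w w f′-ok c-ok ∂f′c)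
            where
            ∂f′c : ∀ y → ∂ f′ y + ∂ c y ≡ lookup d y + lookup d y + δ w y - δ w y
            ∂f′c y = trans (cong₂ _+_ (∂f′ y) (∂c y)) (lemma (lookup d y) (δ (head D) y) (δ w y))
              where
              lemma : ∀ d h w → d + h - w + (d + w - h) ≡ d + d + w - w
              lemma = solve-∀

            f′cs≡fhr : ∀ e → f′ e + (c e + s ⟨ e ⟩) ≡ f e + (h e + r ⟨ e ⟩)
            f′cs≡fhr e = trans (cong (λ i → f′ e + i) (trans (ℤ.+-comm (c e) (s ⟨ e ⟩)) (sc≡hr′ e)))
              (trans (lemma (f′ e) (h e) (r′ e)) (trans (cong (λ i → h e + i) (push-pull (r ⟨_⟩) e)) (lemma (h e) (f e) (r ⟨ e ⟩))))
              where
              lemma : ∀ i j k → i + (j + k) ≡ j + (i + k)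
              lemma = solve-∀

            resolve : (∃₂ λ p′ c′ → (∀ e → p′ ⟨ e ⟩ + c′ e ≡ f′ e + c e) × (∀ e → Allowed e (c′ e)) ×
                         (∀ y → ∂ c′ y ≡ lookup d y + δ w y - δ w y)) → Goal
            resolve (p′ , c′ , p′c′≡f′c , c′-ok , ∂c′)
              with q′ , q′≗c′ ← ∃-point c′ c′-ok (λ y → trans (∂c′ y) (i+j-j≡i (lookup d y) (δ w y)))
              -- `r` is brought next to `p` and `q`, the three are exchanged, and the walk goes on
              -- with `c` in the place of `h` and `s` in that of `r`.
              = permute (prep p (prep q rest↭)) then
                exchange rs ℕ.≤-refl ℕ.≤-refl same then
                approach f′ c (s ∷ rs) p′ q′ (head D) w (rec closer) f′-ok c-ok ∂f′ ∂c p′q′≡f′c sums′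
                  (trans (sym (↭-length rest↭)) len)
              where
              p′q′≡f′c : ∀ e → p′ ⟨ e ⟩ + q′ ⟨ e ⟩ ≡ f′ e + c e
              p′q′≡f′c e = trans (cong (λ i → p′ ⟨ e ⟩ + i) (q′≗c′ e)) (p′c′≡f′c e)

              same : ∀ e → total (p ∷ q ∷ r ∷ []) e ≡ total (p′ ∷ q′ ∷ s ∷ []) e
              same e = begin
                total (p ∷ q ∷ r ∷ []) e           ≡⟨ regroup (p ⟨ e ⟩) (q ⟨ e ⟩) (r ⟨ e ⟩) ⟩
                p ⟨ e ⟩ + q ⟨ e ⟩ + r ⟨ e ⟩        ≡⟨ cong (_+ r ⟨ e ⟩) (pq≡fh e) ⟩
                f e + h e + r ⟨ e ⟩                ≡⟨ ℤ.+-assoc (f e) (h e) (r ⟨ e ⟩) ⟩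
                f e + (h e + r ⟨ e ⟩)              ≡⟨ f′cs≡fhr e ⟨
                f′ e + (c e + s ⟨ e ⟩)             ≡⟨ ℤ.+-assoc (f′ e) (c e) (s ⟨ e ⟩) ⟨
                f′ e + c e + s ⟨ e ⟩               ≡⟨ cong (_+ s ⟨ e ⟩) (p′q′≡f′c e) ⟨
                p′ ⟨ e ⟩ + q′ ⟨ e ⟩ + s ⟨ e ⟩      ≡⟨ regroup (p′ ⟨ e ⟩) (q′ ⟨ e ⟩) (s ⟨ e ⟩) ⟨
                total (p′ ∷ q′ ∷ s ∷ []) e         ∎
                where
                open ≡-Reasoning
                regroup : ∀ i j k → i + (j + (k + 0ℤ)) ≡ i + j + k
                regroup = solve-∀

              sums′ : ∀ e → f′ e + (c e + (s ⟨ e ⟩ + total rs e)) ≡ g ⟨ e ⟩ + total (b ∷ bs) e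
              sums′ e = begin
                f′ e + (c e + (s ⟨ e ⟩ + total rs e))  ≡⟨ regroup (f′ e) (c e) (s ⟨ e ⟩) (total rs e) ⟩
                f′ e + (c e + s ⟨ e ⟩) + total rs e    ≡⟨ cong (_+ total rs e) (f′cs≡fhr e) ⟩
                f e + (h e + r ⟨ e ⟩) + total rs e     ≡⟨ regroup (f e) (h e) (r ⟨ e ⟩) (total rs e) ⟨
                f e + (h e + (r ⟨ e ⟩ + total rs e))   ≡⟨ cong (λ i → f e + (h e + i)) (total-↭ rest↭ e) ⟨
                f e + (h e + total rest e)             ≡⟨ sums e ⟩
                g ⟨ e ⟩ + total (b ∷ bs) e             ∎
                where
                open ≡-Reasoning
                regroup : ∀ i j k m → i + (j + (k + m)) ≡ i + (j + k) + m
                regroup = solve-∀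

        choose : Dec (Toward σ̄ (h e) (b ⟨ e ⟩)) → Goal
        choose (yes h→b) = partner h→b
        choose (no ¬h→b) = third (find-toward σ̄ e rest bs len (toward-+ σ̄ (h e) (b ⟨ e ⟩) h→b ¬h→b))

      from-end : (∃₂ λ e σ → tail (e , σ) ≡ x × ¬ (- (⟦ σ ⟧ * (f e - g ⟨ e ⟩)) ℤ.≤ 0ℤ)) → Goal
      -- A positive contribution to the net inflow of `f - g` at `x` means that a push along the
      -- outgoing dart moves `f` toward `g`.
      from-end (e , σ , refl , pos) =
        step e σ v (subst (ℤ._< 0ℤ) (ℤ.neg-involutive _) (ℤ.neg-mono-< (ℤ.≰⇒> pos))) ∂f ∂h

      excess : x ≢ v → ¬ (∂ (λ e → f e - g ⟨ e ⟩) x ℤ.≤ 0ℤ)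
      excess x≢v le = contradiction (subst (ℤ._≤ 0ℤ) ∂≡1 le) λ { (ℤ.+≤+ ()) }
        where
        lemma : ∀ d → d + 1ℤ - 0ℤ - d ≡ 1ℤ
        lemma = solve-∀

        ∂≡1 : ∂ (λ e → f e - g ⟨ e ⟩) x ≡ 1ℤ
        ∂≡1 = trans (∂-- f (g ⟨_⟩) x) (trans (cong₂ _-_ (∂f x) (point-∂ g x))
          (trans (cong₂ (λ i j → lookup d x + i - j - lookup d x) (δ-refl x) (δ-distinct (x≢v ∘ sym))) (lemma (lookup d x))))

      from-anywhere : x ≡ v → ∀ e → f e - g ⟨ e ⟩ ≢ 0ℤ → Goal
      -- `f` and `h` are both proper now, so a new walk may start at any edge where `f` differs from
      -- `g`.
      from-anywhere refl e f≢g with σ , f→g ← ≢⇒sign f≢g =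
        step e σ (tail (e , σ)) f→g
          (λ y → trans (∂f y) (lemma (lookup d y) (δ x y) (δ (tail (e , σ)) y)))
          (λ y → trans (∂h y) (lemma (lookup d y) (δ x y) (δ (tail (e , σ)) y)))
        where
        lemma : ∀ a b c → a + b - b ≡ a + c - c
        lemma = solve-∀

      arrived : x ≡ v → (∀ e → f e - g ⟨ e ⟩ ≡ 0ℤ) → Goal
      -- `f` has become `g` and `h` is proper. An exchange of two flows sets `g` aside, and the
      -- induction hypothesis treats the remaining rows.
      arrived refl f-g≡0 with h′ , h′≗h ← ∃-point h h-ok (λ y → trans (∂h y) (i+j-j≡i (lookup d y) (δ x y)))
        = exchange rest (s≤s (s≤s z≤n)) (s≤s (s≤s z≤n)) same then
          ⇝-prep g (IH (h′ ∷ rest) (cong ℕ.suc len) sums′)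
        where
        f≗g : ∀ e → f e ≡ g ⟨ e ⟩
        f≗g e = ℤ.i-j≡0⇒i≡j (f e) (g ⟨ e ⟩) (f-g≡0 e)

        same : ∀ e → total (p ∷ q ∷ []) e ≡ total (g ∷ h′ ∷ []) e
        same e = trans (sym (ℤ.+-assoc (p ⟨ e ⟩) (q ⟨ e ⟩) 0ℤ))
          (trans (cong (_+ 0ℤ) (trans (pq≡fh e) (cong₂ _+_ (f≗g e) (sym (h′≗h e)))))
            (ℤ.+-assoc (g ⟨ e ⟩) (h′ ⟨ e ⟩) 0ℤ))

        sums′ : ∀ e → total (h′ ∷ rest) e ≡ total (b ∷ bs) e
        sums′ e = trans (cong (_+ total rest e) (h′≗h e))
          (+-cancelˡ (f e) _ _ (trans (sums e) (cong (_+ total (b ∷ bs) e) (sym (f≗g e)))))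

      go : Dec (x ≡ v) → Dec (∃ λ e → f e - g ⟨ e ⟩ ≢ 0ℤ) → Goal
      go (no  x≢v) _               = from-end (∃-dart (ℤ._≤? 0ℤ) ℤ.≤-refl ℤ.+-mono-≤ (λ e → f e - g ⟨ e ⟩) x (excess x≢v))
      go (yes x≡v) (yes (e , f≢g)) = from-anywhere x≡v e f≢g
      go (yes x≡v) (no  f≡g)       = arrived x≡v (λ e → decidable-stable (_ ℤ.≟ _) (λ f≢g → f≡g (e , f≢g)))

  -- Induction on the lengths. The first two flows serve both as the pair `f`, `h` and as its
  -- representatives; `x` is the surplus and the deficit vertex at once, so there is no defect at
  -- the start.
  connected : Fin #V → ∀ ps qs → length ps ≡ length qs → (∀ e → total ps e ≡ total qs e) → ps ⇝ qs
  connected x []       []       len sums = permute ↭-refl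
  connected x (p ∷ []) (q ∷ []) len sums = exchange [] (s≤s z≤n) (s≤s z≤n) sums
  connected x (p ∷ q ∷ rest) (g ∷ b ∷ bs) len sums =
    approach g b bs (λ ps → connected x ps (b ∷ bs)) (p ⟨_⟩) (q ⟨_⟩) rest p q x x (<-wellFounded _)
      (point-allowed p) (point-allowed q)
      (λ y → trans (point-∂ p y) (sym (i+j-j≡i (lookup d y) (δ x y)))) (λ y → trans (point-∂ q y) (sym (i+j-j≡i (lookup d y) (δ x y))))
      (λ e → refl) sums (ℕ.suc-injective (ℕ.suc-injective len))

lookup-injective : ∀ {a} {A : Set a} {n} {xs ys : Vec A n} → (∀ i → lookup xs i ≡ lookup ys i) → xs ≡ ys
lookup-injective {xs = xs} {ys} eq = begin
  xs                   ≡⟨ tabulate∘lookup xs ⟨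
  tabulate (lookup xs) ≡⟨ tabulate-cong eq ⟩
  tabulate (lookup ys) ≡⟨ tabulate∘lookup ys ⟩
  ys                   ∎
  where open ≡-Reasoning

-- Total coefficients in formal sums.

module Mass {c ℓ x} (K : CommutativeRing c ℓ) (X : Set x) where
  private module K = CommutativeRing K
  open K using (_≈_)
  open import Relation.Binary.Reasoning.Setoid K.setoid

  Terms : Set (c ⊔ x)
  Terms = List (K.Carrier × X)

  -- The coefficients of p and of φ p are the masses for the predicates (k ↭_) and
  -- (λ m → t ≡ exponent m).
  opaque
    mass : ∀ {p} {P : Pred X p} → Decidable P → Terms → K.Carrier
    mass P? []            = K.0#
    mass P? ((a , x) ∷ p) = if does (P? x) then a K.+ mass P? p else mass P? p

  module _ {p} {P : Pred X p} (P? : Decidable P) where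

    opaque
      unfolding mass

      mass-[] : mass P? [] ≈ K.0#
      mass-[] = K.refl

      mass-yes : ∀ {a x p} → P x → mass P? ((a , x) ∷ p) ≡ a K.+ mass P? p
      mass-yes {a} {x} {p} Px = cong (if_then a K.+ mass P? p else mass P? p) (dec-true (P? x) Px)

      mass-∷-cong : ∀ {a b x y p q} → a ≈ b → P x ⇔ P y → mass P? p ≈ mass P? q →
                    mass P? ((a , x) ∷ p) ≈ mass P? ((b , y) ∷ q)
      mass-∷-cong {x = x} {y} a≈b x⇔y p≈q with P? x | P? y
      ... | yes _  | yes _  = K.+-cong a≈b p≈q
      ... | yes Px | no ¬Py = contradiction (Equivalence.to x⇔y Px) ¬Py
      ... | no ¬Px | yes Py = contradiction (Equivalence.from x⇔y Py) ¬Px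
      ... | no _   | no _   = p≈q

      mass-drop : ∀ {a x p} → a ≈ K.0# → mass P? ((a , x) ∷ p) ≈ mass P? p
      mass-drop {x = x} a≈0 with P? x
      ... | yes _ = K.trans (K.+-congʳ a≈0) (K.+-identityˡ _)
      ... | no  _ = K.refl

      mass-merge : ∀ {a b x y p} → P x ⇔ P y →
                   mass P? ((a , x) ∷ (b , y) ∷ p) ≈ mass P? ((a K.+ b , y) ∷ p)
      mass-merge {x = x} {y} x⇔y with P? x | P? y
      ... | yes _  | yes _  = K.sym (K.+-assoc _ _ _)
      ... | yes Px | no ¬Py = contradiction (Equivalence.to x⇔y Px) ¬Py
      ... | no ¬Px | yes Py = contradiction (Equivalence.from x⇔y Py) ¬Px
      ... | no _   | no _   = K.refl

      mass-swap : ∀ {a b x y p q} → mass P? p ≈ mass P? q →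
                  mass P? ((a , x) ∷ (b , y) ∷ p) ≈ mass P? ((b , y) ∷ (a , x) ∷ q)
      mass-swap {a} {b} {x} {y} {p} {q} p≈q with P? x | P? y
      ... | no  _ | no  _ = p≈q
      ... | no  _ | yes _ = K.+-congˡ p≈q
      ... | yes _ | no  _ = K.+-congˡ p≈q
      ... | yes _ | yes _ = begin
        a K.+ (b K.+ mass P? p) ≈⟨ K.+-assoc a b _ ⟨
        a K.+ b K.+ mass P? p   ≈⟨ K.+-cong (K.+-comm a b) p≈q ⟩
        b K.+ a K.+ mass P? q   ≈⟨ K.+-assoc b a _ ⟩
        b K.+ (a K.+ mass P? q) ∎

      mass-++ : ∀ p q → mass P? (p ++ q) ≈ mass P? p K.+ mass P? q
      mass-++ []            q = K.sym (K.+-identityˡ _)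
      mass-++ ((a , x) ∷ p) q with P? x
      ... | yes _ = K.trans (K.+-congˡ (mass-++ p q)) (K.sym (K.+-assoc a _ _))
      ... | no  _ = mass-++ p q

      mass-none : ∀ p → ¬ Any (P ∘ proj₂) p → mass P? p ≈ K.0#
      mass-none []            ¬any = K.refl
      mass-none ((a , x) ∷ p) ¬any with P? x
      ... | yes Px = contradiction (here Px) ¬any
      ... | no _   = mass-none p (¬any ∘ there)

      -- Models multiplication by a single term: `a` scales the coefficients and `f` moves the
      -- monomials, so the class `P` pulls back to `Q`.
      mass-scale : ∀ {q} {Q : Pred X q} (Q? : Decidable Q) a (f : X → X) → (∀ x → P (f x) ⇔ Q x) →
                   ∀ p → mass P? (List.map (λ (b , x) → (a K.* b , f x)) p) ≈ a K.* mass Q? p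
      mass-scale Q? a f f⇔ []            = K.sym (K.zeroʳ a)
      mass-scale Q? a f f⇔ ((b , x) ∷ p) with P? (f x) | Q? x
      ... | yes _  | yes _  = K.trans (K.+-congˡ (mass-scale Q? a f f⇔ p)) (K.sym (K.distribˡ a b _))
      ... | yes Px | no ¬Qx = contradiction (Equivalence.to (f⇔ x) Px) ¬Qx
      ... | no ¬Px | yes Qx = contradiction (Equivalence.from (f⇔ x) Qx) ¬Px
      ... | no _   | no _   = mass-scale Q? a f f⇔ p

    mass-↭ : ∀ {p q} → p ↭ q → mass P? p ≈ mass P? q
    mass-↭ _↭_.refl             = K.refl
    mass-↭ (prep (a , x) p↭q)   = mass-∷-cong {x = x} K.refl ⇔-refl (mass-↭ p↭q)
    mass-↭ (swap _ _ p↭q)       = mass-swap (mass-↭ p↭q)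
    mass-↭ (_↭_.trans p↭q q↭r)  = K.trans (mass-↭ p↭q) (mass-↭ q↭r)

  module _ {r} {_~_ : Rel X r} (~-isEquivalence : IsEquivalence _~_) (_~?_ : Binary.Decidable _~_) where
    private module ~ = IsEquivalence ~-isEquivalence

    ~⇒⇔ : ∀ {x y} z → x ~ y → (z ~ x) ⇔ (z ~ y)
    ~⇒⇔ z x~y = mk⇔ (λ z~x → ~.trans z~x x~y) (λ z~y → ~.trans z~y (~.sym x~y))

    Vanishes : Terms → Set (ℓ ⊔ x)
    Vanishes p = ∀ z → mass (z ~?_) p ≈ K.0#

    module _ {q} (Q : Pred Terms q) (Q-[] : Q []) (Q-↭ : ∀ {p p′} → p ↭ p′ → Q p → Q p′)
      (Q-drop : ∀ {a x p} → a ≈ K.0# → Q p → Q ((a , x) ∷ p))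
      (Q-merge : ∀ {a b x y p} → x ~ y → Q ((a K.+ b , y) ∷ p) → Q ((a , x) ∷ (b , y) ∷ p))
      where

      -- The head term is merged with a later term of its class; when there is none, its coefficient
      -- is the whole total of the class, hence 0, and it is dropped. Each move shortens the sum.
      -- The classes used are those of permutation and of equal exponent.
      vanishing-induction : ∀ p → Vanishes p → Q p
      vanishing-induction p = go (length p) p ℕ.≤-refl
        where
        go : ∀ n p → length p ℕ.≤ n → Vanishes p → Q p
        go n         []            _         _ = Q-[]
        go (ℕ.suc n) ((a , x) ∷ p) (s≤s len) vanishes with any? (λ (b , y) → x ~? y) p
        ... | no ¬any = Q-drop a≈0 (go n p len λ z → K.trans (K.sym (mass-drop (z ~?_) {x = x} a≈0)) (vanishes z))
          where
          a≈0 : a ≈ K.0#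
          a≈0 = begin
            a                              ≈⟨ K.+-identityʳ a ⟨
            a K.+ K.0#                     ≈⟨ K.+-congˡ (mass-none (x ~?_) p ¬any) ⟨
            a K.+ mass (x ~?_) p           ≡⟨ mass-yes (x ~?_) ~.refl ⟨
            mass (x ~?_) ((a , x) ∷ p)     ≈⟨ vanishes x ⟩
            K.0#                           ∎
        ... | yes any with (b , y) , y∈p , x~y ← find any with ps , qs , refl ← ∈-∃++ y∈p =
          Q-↭ (↭-sym p↭) (Q-merge x~y (go n ((a K.+ b , y) ∷ ps ++ qs)
            (subst (ℕ._≤ n) (↭-length (shift (b , y) ps qs)) len) λ z →
            K.trans (K.sym (K.trans (mass-↭ (z ~?_) p↭) (mass-merge (z ~?_) (~⇒⇔ z x~y)))) (vanishes z)))
          where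
          p↭ : (a , x) ∷ ps ++ (b , y) ∷ qs ↭ (a , x) ∷ (b , y) ∷ ps ++ qs
          p↭ = prep (a , x) (shift (b , y) ps qs)

-- Exponents of monomials.

module _ {c ℓ} (K : CommutativeRing c ℓ) (G : Digraph)
  (d : Vec ℤ (Digraph.#V G)) (u l : Vec ℤ (Digraph.#E G)) where
  open Digraph G
  private module K = CommutativeRing K
  open K using (_≈_)
  open Incidence G using (∂; ∂-+; ∂-cong)
  open Flows G d u l using (point-∂; total; total-↭; _⇝_; permute; exchange; _then_; connected)
  open Toric K (FlowPolytopePoint G d u l)
  open Mass K (List Point)
  open import Relation.Binary.Reasoning.Setoid K.setoid

  lookup-exponent : ∀ ps e → lookup (exponent ps) e ≡ total ps e
  lookup-exponent []       e = lookup-replicate e 0ℤ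
  lookup-exponent (p ∷ ps) e = trans (lookup-zipWith _+_ e (value p) (exponent ps)) (cong (λ i → lookup (value p) e + i) (lookup-exponent ps e))

  exponent⇒total : ∀ {m n} → exponent m ≡ exponent n → ∀ e → total m e ≡ total n e
  exponent⇒total {m} {n} eq e = trans (sym (lookup-exponent m e)) (trans (cong (λ v → lookup v e) eq) (lookup-exponent n e))

  total⇒exponent : ∀ {m n} → (∀ e → total m e ≡ total n e) → exponent m ≡ exponent n
  total⇒exponent {m} {n} eq = lookup-injective λ e → trans (lookup-exponent m e) (trans (eq e) (sym (lookup-exponent n e)))

  total-++ : ∀ m n e → total (m ++ n) e ≡ total m e + total n e
  total-++ []      n e = sym (ℤ.+-identityˡ _)
  total-++ (p ∷ m) n e = trans (cong (λ i → lookup (value p) e + i) (total-++ m n e)) (sym (ℤ.+-assoc (lookup (value p) e) (total m e) (total n e)))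

  ∂-total : ∀ m v → ∂ (total m) v ≡ + length m * lookup d v
  ∂-total []      v = trans (∂-cong (λ _ → refl) v) (∂-0 v)
    where
    ∂-0 : ∀ v → ∂ (λ _ → 0ℤ) v ≡ 0ℤ
    ∂-0 v = trans (sum-cong-≗ (λ e → ℤ.*-zeroʳ (Incidence.ι G v e))) (sum-replicate-zero #E)
  ∂-total (p ∷ m) v = trans (∂-+ (lookup (value p)) (total m) v)
    (trans (cong₂ _+_ (point-∂ p v) (∂-total m v)) (sym (ℤ.suc-* (+ length m) (lookup d v))))

  -- The net inflow at `v` of a sum of flows is their number times a nonzero demand, which
  -- determines the number.
  exponent⇒length : ∀ v → lookup d v ≢ 0ℤ → ∀ {m n} → exponent m ≡ exponent n → length m ≡ length n
  exponent⇒length v dv≢0 {m} {n} eq = ℤ.+-injective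
    (ℤ.*-cancelʳ-≡ (+ length m) (+ length n) (lookup d v) {{ℤ.≢-nonZero dv≢0}}
      (trans (sym (∂-total m v)) (trans (∂-cong (exponent⇒total {m} {n} eq) v) (∂-total n v))))

  _↭?_ : Binary.Decidable (_↭_ {A = Point})
  _↭?_ = ↭-decidable (Refinement._≟_ _≟ᵛ_)

  exponent? : ∀ t (m : List Point) → Dec (t ≡ exponent m)
  exponent? t m = t ≟ᵛ exponent m

  opaque
    unfolding mass

    coefficient≡mass : ∀ k p → coefficient k p ≡ mass (k ↭?_) p
    coefficient≡mass k []            = refl
    coefficient≡mass k ((a , m) ∷ p) = cong (λ i → if does (k ↭? m) then a K.+ i else i) (coefficient≡mass k p)

    coefficient-φ≡mass : ∀ t p → Laurent.coefficient t (φ p) ≡ mass (exponent? t) p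
    coefficient-φ≡mass t []            = refl
    coefficient-φ≡mass t ((a , m) ∷ p) =
      cong (λ i → if does (exponent? t m) then a K.+ i else i) (coefficient-φ≡mass t p)

  by-mass : ∀ {p q} → (∀ k → mass (k ↭?_) p ≈ mass (k ↭?_) q) → ∀ k → coefficient k p ≈ coefficient k q
  by-mass {p} {q} eq k = begin
    coefficient k p  ≡⟨ coefficient≡mass k p ⟩
    mass (k ↭?_) p   ≈⟨ eq k ⟩
    mass (k ↭?_) q   ≡⟨ coefficient≡mass k q ⟨
    coefficient k q  ∎

  ↭⇒⇔ : ∀ {m n : List Point} k → m ↭ n → (k ↭ m) ⇔ (k ↭ n)
  ↭⇒⇔ = ~⇒⇔ ↭-isEquivalence _↭?_

  -- Binomials of degree at most three.

  Binomial-terms : List Point → List Point → Poly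
  Binomial-terms m n = (K.1# , m) ∷ (K.- K.1# , n) ∷ []

  data Binomial : Pred Poly (c ⊔ ℓ) where
    binomial : ∀ {m n} → length m ℕ.≤ 3 → length n ℕ.≤ 3 → (∀ e → total m e ≡ total n e) →
               Binomial (Binomial-terms m n)

  binomial-degree : ∀ {p} → Binomial p → DegreeAtMost 3 p
  binomial-degree (binomial {m} {n} m≤3 n≤3 _) k 3<k = begin
    coefficient k (Binomial-terms m n)  ≡⟨ coefficient≡mass k (Binomial-terms m n) ⟩
    mass (k ↭?_) (Binomial-terms m n)   ≈⟨ mass-none (k ↭?_) (Binomial-terms m n) none ⟩
    K.0#                                ∎
    where
    none : ¬ Any ((k ↭_) ∘ proj₂) (Binomial-terms m n)
    none (here k↭m)         = ℕ.<⇒≱ 3<k (subst (ℕ._≤ 3) (sym (↭-length k↭m)) m≤3)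
    none (there (here k↭n)) = ℕ.<⇒≱ 3<k (subst (ℕ._≤ 3) (sym (↭-length k↭n)) n≤3)

  -- The binomials lie in the toric ideal.

  φ-Vanishes : Pred Poly ℓ
  φ-Vanishes p = ∀ t → mass (exponent? t) p ≈ K.0#

  toric⇒vanishes : ∀ {p} → toricIdeal p → φ-Vanishes p
  toric⇒vanishes {p} I t = K.trans (K.reflexive (sym (coefficient-φ≡mass t p))) (I t)

  vanishes⇒toric : ∀ {p} → φ-Vanishes p → toricIdeal p
  vanishes⇒toric {p} V t = K.trans (K.reflexive (coefficient-φ≡mass t p)) (V t)

  ≡⇒⇔ : ∀ {m n : List Point} t → exponent m ≡ exponent n → (t ≡ exponent m) ⇔ (t ≡ exponent n)
  ≡⇒⇔ t eq = mk⇔ (λ t≡ → trans t≡ eq) (λ t≡ → trans t≡ (sym eq))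

  binomial-vanishes : ∀ m n → exponent m ≡ exponent n → φ-Vanishes (Binomial-terms m n)
  binomial-vanishes m n eq t = K.trans (mass-merge (exponent? t) {x = m} (≡⇒⇔ {m} {n} t eq))
    (K.trans (mass-drop (exponent? t) (K.-‿inverseʳ K.1#)) (mass-[] (exponent? t)))

  -- Permuted monomials have equal exponents, so a formal sum that is zero as a polynomial maps to
  -- zero; `φ` is thus well defined up to equality.
  zero⇒vanishes : ∀ p → (∀ k → mass (k ↭?_) p ≈ K.0#) → φ-Vanishes p
  zero⇒vanishes p zero-p t = vanishing-induction ↭-isEquivalence _↭?_ (λ p → mass (exponent? t) p ≈ K.0#)
    (mass-[] (exponent? t))
    (λ p↭q → K.trans (K.sym (mass-↭ (exponent? t) p↭q)))
    (λ {a} {m} a≈0 → K.trans (mass-drop (exponent? t) {x = m} a≈0))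
    (λ {a} {b} {m} {n} m↭n → K.trans (mass-merge (exponent? t) {x = m} (≡⇒⇔ {m} {n} t (total⇒exponent {m} {n} (total-↭ m↭n)))))
    p zero-p

  -- Written as a scaling by -1 so that `mass-scale` applies.
  negate : Poly → Poly
  negate = List.map (λ (a , m) → (K.- K.1# K.* a , m))

  -- The difference of `q` and `p` is zero as a polynomial, so its image is zero, and the image of
  -- `p` is zero by assumption.
  vanishes-respects : ∀ {p q} → (∀ k → coefficient k p ≈ coefficient k q) → φ-Vanishes p → φ-Vanishes q
  vanishes-respects {p} {q} p≈q V t = begin
    mass (exponent? t) q                                         ≈⟨ K.+-identityʳ _ ⟨
    mass (exponent? t) q K.+ K.0#                                ≈⟨ K.+-congˡ (K.zeroʳ _) ⟨
    mass (exponent? t) q K.+ K.- K.1# K.* K.0#                   ≈⟨ K.+-congˡ (K.*-congˡ (V t)) ⟨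
    mass (exponent? t) q K.+ K.- K.1# K.* mass (exponent? t) p   ≈⟨ difference (exponent? t) ⟨
    mass (exponent? t) (q ++ negate p)                           ≈⟨ zero⇒vanishes (q ++ negate p) coefficients t ⟩
    K.0#                                                         ∎
    where
    difference : ∀ {a} {P : Pred (List Point) a} (P? : Decidable P) →
                 mass P? (q ++ negate p) ≈ mass P? q K.+ K.- K.1# K.* mass P? p
    difference P? = K.trans (mass-++ P? q (negate p))
      (K.+-congˡ (mass-scale P? P? (K.- K.1#) (λ m → m) (λ _ → ⇔-refl) p))

    coefficients : ∀ k → mass (k ↭?_) (q ++ negate p) ≈ K.0#
    coefficients k = begin
      mass (k ↭?_) (q ++ negate p)                            ≈⟨ difference (k ↭?_) ⟩
      mass (k ↭?_) q K.+ K.- K.1# K.* mass (k ↭?_) p          ≈⟨ K.+-cong (K.*-identityˡ _) (K.*-congˡ p≈q′) ⟨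
      K.1# K.* mass (k ↭?_) q K.+ K.- K.1# K.* mass (k ↭?_) q ≈⟨ K.distribʳ _ K.1# (K.- K.1#) ⟨
      (K.1# K.- K.1#) K.* mass (k ↭?_) q                      ≈⟨ K.*-congʳ (K.-‿inverseʳ K.1#) ⟩
      K.0# K.* mass (k ↭?_) q                                 ≈⟨ K.zeroˡ _ ⟩
      K.0#                                                    ∎
      where
      p≈q′ : mass (k ↭?_) q ≈ mass (k ↭?_) p
      p≈q′ = begin
        mass (k ↭?_) q   ≡⟨ coefficient≡mass k q ⟨
        coefficient k q  ≈⟨ p≈q k ⟨
        coefficient k p  ≡⟨ coefficient≡mass k p ⟩
        mass (k ↭?_) p   ∎

  -- Multiplication by the monomial `m` translates exponents: the part of the product over `t` comes
  -- from the part of `q` over `t` minus the exponent of `m`.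
  vanishes-multiply : ∀ p {q} → φ-Vanishes q → φ-Vanishes (RawRing._*_ polynomialRing p q)
  vanishes-multiply []                V t = mass-[] (exponent? t)
  vanishes-multiply ((a , m) ∷ p) {q} V t = begin
    mass (exponent? t) (multiple ++ rest)                  ≈⟨ mass-++ (exponent? t) multiple rest ⟩
    mass (exponent? t) multiple K.+ mass (exponent? t) rest
      ≈⟨ K.+-cong (mass-scale (exponent? t) (exponent? t-m) a (m ++_) shifted q) (vanishes-multiply p {q} V t) ⟩
    a K.* mass (exponent? t-m) q K.+ K.0#                   ≈⟨ K.+-identityʳ _ ⟩
    a K.* mass (exponent? t-m) q                           ≈⟨ K.*-congˡ (V t-m) ⟩
    a K.* K.0#                                             ≈⟨ K.zeroʳ a ⟩
    K.0#                                                   ∎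
    where
    multiple rest : Poly
    multiple = List.map (λ (b , n) → (a K.* b , m ++ n)) q
    rest     = RawRing._*_ polynomialRing p q

    t-m : Vec ℤ #E
    t-m = zipWith _-_ t (exponent m)

    i+j-i≡j : ∀ i j → i + j - i ≡ j
    i+j-i≡j = solve-∀

    i+[j-i]≡j : ∀ i j → i + (j - i) ≡ j
    i+[j-i]≡j = solve-∀

    exponent-++ : ∀ n e → lookup (exponent (m ++ n)) e ≡ lookup (exponent m) e + lookup (exponent n) e
    exponent-++ n e = trans (lookup-exponent (m ++ n) e)
      (trans (total-++ m n e) (sym (cong₂ _+_ (lookup-exponent m e) (lookup-exponent n e))))

    shifted : ∀ n → (t ≡ exponent (m ++ n)) ⇔ (t-m ≡ exponent n)
    shifted n = mk⇔
      (λ { refl → lookup-injective λ e → trans (lookup-zipWith _-_ e (exponent (m ++ n)) (exponent m))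
        (trans (cong (_- lookup (exponent m) e) (exponent-++ n e)) (i+j-i≡j (lookup (exponent m) e) (lookup (exponent n) e))) })
      (λ t-m≡n → lookup-injective λ e → sym (trans (exponent-++ n e)
        (trans (cong (λ v → lookup (exponent m) e + lookup v e) (sym t-m≡n))
          (trans (cong (λ i → lookup (exponent m) e + i) (lookup-zipWith _-_ e t (exponent m)))
            (i+[j-i]≡j (lookup (exponent m) e) (lookup t e))))))

  ⟨Binomial⟩⇒vanishes : ∀ {p} → ⟨ Binomial ⟩ p → φ-Vanishes p
  ⟨Binomial⟩⇒vanishes (generator (binomial {m} {n} _ _ eq)) = binomial-vanishes m n (total⇒exponent {m} {n} eq)
  ⟨Binomial⟩⇒vanishes zero t = mass-[] (exponent? t)
  ⟨Binomial⟩⇒vanishes (add {p} {q} p∈ q∈) t = K.trans (mass-++ (exponent? t) p q)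
    (K.trans (K.+-cong (⟨Binomial⟩⇒vanishes p∈ t) (⟨Binomial⟩⇒vanishes q∈ t)) (K.+-identityˡ _))
  ⟨Binomial⟩⇒vanishes (multiply p {q} q∈) = vanishes-multiply p {q} (⟨Binomial⟩⇒vanishes q∈)
  ⟨Binomial⟩⇒vanishes (respects {p} {q} p≈q p∈) = vanishes-respects {p} {q} p≈q (⟨Binomial⟩⇒vanishes p∈)

  -- The binomials generate the toric ideal.

  -- A permutation gives the zero polynomial, an exchange a generator multiplied by the monomial
  -- `rs`, and in a composite the middle monomial cancels.
  ⇝⇒∈⟨Binomial⟩ : ∀ {m n} → m ⇝ n → ⟨ Binomial ⟩ (Binomial-terms m n)
  ⇝⇒∈⟨Binomial⟩ {m} {n} (permute m↭n) = respects (by-mass {[]} {Binomial-terms m n} λ k → K.sym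
    (K.trans (mass-merge (k ↭?_) (↭⇒⇔ k m↭n)) (mass-drop (k ↭?_) {x = n} (K.-‿inverseʳ K.1#)))) zero
  ⇝⇒∈⟨Binomial⟩ (exchange {ps} {qs} rs ps≤3 qs≤3 eq) =
    respects
      (by-mass {(K.1# K.* K.1# , rs ++ ps) ∷ (K.1# K.* K.- K.1# , rs ++ qs) ∷ []} {Binomial-terms (ps ++ rs) (qs ++ rs)} λ k →
        mass-∷-cong (k ↭?_) (K.*-identityˡ _) (↭⇒⇔ k (++-comm rs ps))
          (mass-∷-cong (k ↭?_) {p = []} {q = []} (K.*-identityˡ _) (↭⇒⇔ k (++-comm rs qs)) K.refl))
      (multiply ((K.1# , rs) ∷ []) (generator (binomial ps≤3 qs≤3 eq)))
  ⇝⇒∈⟨Binomial⟩ (_then_ {m} {n} {o} m⇝n n⇝o) =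
    respects
      (by-mass {Binomial-terms m n ++ Binomial-terms n o} {Binomial-terms m o} λ k →
        mass-∷-cong (k ↭?_) {x = m} K.refl ⇔-refl
          (K.trans (mass-merge (k ↭?_) {x = n} ⇔-refl) (mass-drop (k ↭?_) {x = n} (K.-‿inverseˡ K.1#))))
      (add (⇝⇒∈⟨Binomial⟩ m⇝n) (⇝⇒∈⟨Binomial⟩ n⇝o))

  -- Modulo the binomials, monomials of equal exponent coincide, as `connected` joins them; terms
  -- over one exponent can then be merged until their coefficient is 0.
  vanishes⇒∈⟨Binomial⟩ : ∀ v → lookup d v ≢ 0ℤ → ∀ p → φ-Vanishes p → ⟨ Binomial ⟩ p
  vanishes⇒∈⟨Binomial⟩ v dv≢0 p V =
    vanishing-induction (On.isEquivalence exponent isEquivalence) (λ m n → exponent m ≟ᵛ exponent n) ⟨ Binomial ⟩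
      zero
      (λ {p} {q} p↭q → respects (by-mass {p} {q} λ k → mass-↭ (k ↭?_) p↭q))
      (λ {a} {m} {p} a≈0 → respects (by-mass {p} {(a , m) ∷ p} λ k → K.sym (mass-drop (k ↭?_) {x = m} a≈0)))
      merge p (λ m → V (exponent m))
    where
    cancel : ∀ a b → a K.* K.- K.1# K.+ (a K.+ b) ≈ b
    cancel a b = begin
      a K.* K.- K.1# K.+ (a K.+ b)          ≈⟨ K.+-assoc _ a b ⟨
      a K.* K.- K.1# K.+ a K.+ b            ≈⟨ K.+-congʳ (K.+-congˡ (K.*-identityʳ a)) ⟨
      a K.* K.- K.1# K.+ a K.* K.1# K.+ b   ≈⟨ K.+-congʳ (K.distribˡ a _ _) ⟨
      a K.* (K.- K.1# K.+ K.1#) K.+ b       ≈⟨ K.+-congʳ (K.trans (K.*-congˡ (K.-‿inverseˡ K.1#)) (K.zeroʳ a)) ⟩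
      K.0# K.+ b                            ≈⟨ K.+-identityˡ b ⟩
      b                                     ∎

    merge : ∀ {a b m n p} → exponent m ≡ exponent n → ⟨ Binomial ⟩ ((a K.+ b , n) ∷ p) → ⟨ Binomial ⟩ ((a , m) ∷ (b , n) ∷ p)
    -- Adding `a` times the binomial of `m` and `n` turns the coefficient `a + b` of `n` into `b`
    -- and puts `a` at `m`.
    merge {a} {b} {m} {n} {p} eq p∈ =
      respects
        (by-mass {(a K.* K.1# , m) ∷ (a K.* K.- K.1# , n) ∷ (a K.+ b , n) ∷ p} {(a , m) ∷ (b , n) ∷ p} λ k →
          mass-∷-cong (k ↭?_) {x = m} (K.*-identityʳ a) ⇔-refl
            (K.trans (mass-merge (k ↭?_) {x = n} ⇔-refl) (mass-∷-cong (k ↭?_) {x = n} (cancel a b) ⇔-refl K.refl)))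
        (add (multiply ((a , []) ∷ [])
          (⇝⇒∈⟨Binomial⟩ (connected v m n (exponent⇒length v dv≢0 {m} {n} eq) (exponent⇒total {m} {n} eq)))) p∈)

  generatedInDegree-3 : d ≢ replicate #V 0ℤ → GeneratedInDegree 3 toricIdeal
  generatedInDegree-3 d≢0
    -- A vertex of nonzero demand makes the exponent determine the degree, and it is also the
    -- initial vertex handed to `connected`.
    with v , dv≢0 ← Fin.¬∀⟶∃¬ #V (λ v → lookup d v ≡ 0ℤ) (λ v → lookup d v ℤ.≟ 0ℤ)
           (λ d≗0 → d≢0 (lookup-injective λ v → trans (d≗0 v) (sym (lookup-replicate v 0ℤ))))
    = Binomial , binomial-degree ,
      (λ {p} p∈ → vanishes⇒toric {p} (⟨Binomial⟩⇒vanishes p∈)) ,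
      (λ {p} p∈I → vanishes⇒∈⟨Binomial⟩ v dv≢0 p (toric⇒vanishes {p} p∈I))

mainTheorem1 : ∀ {c ℓ₁ ℓ₂} (k : HeytingField c ℓ₁ ℓ₂) (G : Digraph) (let open Digraph G)
    (d : Vec ℤ #V) → d ≢ replicate #V 0ℤ → (u l : Vec ℤ #E) →
    let open Toric (fieldRing k) (FlowPolytopePoint G d u l)
    in GeneratedInDegree 3 toricIdeal
mainTheorem1 k G d d≢0 u l = generatedInDegree-3 (fieldRing k) G d u l d≢0
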